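{- For every integer $n\geq 45$, \[ ex(n,K_4,B_{4,1})=\left\lfloor\frac{(n-2)^2}{4}\right\rfloor, \] and, up to isomorphism, $K_2\vee T_2(n-2)$ is the unique $B_{4,1}$-free graph on $n$ vertices containing exactly $\lfloor (n-2)^2/4\rfloor$ copies of $K_4$.
   Context: For integers $0\le s<r$, $B_{r,s}$ denotes the graph consisting of two copies of $K_r$ that share exactly $s$ vertices. A graph is $F$-free if it contains no subgraph isomorphic to $F$. For graphs $T,F$, $ex(n,T,F)$ denotes the maximum number of copies of $T$ in an $F$-free graph on $n$ vertices. $T_r(m)$ denotes the $r$-partite Turán graph on $m$ vertices, i.e. the complete $r$-partite graph on $m$ vertices whose part sizes differ by at most one. The join $G_1\vee G_2$ is the disjoint union of $G_1$ and $G_2$ together with all edges between $V(G_1)$ and $V(G_2)$. -}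

module Defs where

open import Data.Nat using (ℕ; zero; suc; _∸_; _+_; _%_; _≡ᵇ_; _<ᵇ_)
open import Data.Bool using (Bool; true; false; not; _∧_; _∨_; if_then_else_)
open import Data.Bool.Properties using (∧-comm; ∨-comm)
open import Data.Fin using (Fin; toℕ; _≟_; _<?_)
open import Data.List using (List; map; allFin)
open import Data.Nat.ListAction using (sum)
open import Data.Product using (Σ; ∃; _×_; _,_)
open import Relation.Nullary using (¬_; yes; no)
open import Relation.Nullary.Decidable using (⌊_⌋)
open import Relation.Binary.PropositionalEquality using (_≡_; refl; sym; cong)
open import Function.Definitions using (Injective; Bijective)

record Graph (n : ℕ) : Set where
  field
    adj    : Fin n → Fin n → Bool
    adj-sym : ∀ i j → adj i j ≡ adj j i
    adj-irrefl : ∀ i → adj i i ≡ false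
open Graph public

eqᵇ : ∀ {n} → Fin n → Fin n → Bool
eqᵇ i j = ⌊ i ≟ j ⌋

eqᵇ-sym : ∀ {n} (i j : Fin n) → eqᵇ i j ≡ eqᵇ j i
eqᵇ-sym i j with i ≟ j | j ≟ i
... | yes _ | yes _ = refl
... | no _  | no _  = refl
... | yes p | no q  = Data.Empty.⊥-elim (q (sym p)) where import Data.Empty
... | no p  | yes q = Data.Empty.⊥-elim (p (sym q)) where import Data.Empty

eqᵇ-refl : ∀ {n} (i : Fin n) → eqᵇ i i ≡ true
eqᵇ-refl i with i ≟ i
... | yes _ = refl
... | no p  = Data.Empty.⊥-elim (p refl) where import Data.Empty

mkGraph : ∀ {n} (r : Fin n → Fin n → Bool) → (∀ i j → r i j ≡ r j i) → Graph n
mkGraph r rs = record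
  { adj    = λ i j → not (eqᵇ i j) ∧ r i j
  ; adj-sym = λ i j → Relation.Binary.PropositionalEquality.cong₂ (λ a b → not a ∧ b) (eqᵇ-sym i j) (rs i j)
  ; adj-irrefl = λ i → cong (λ a → not a ∧ r i i) (eqᵇ-refl i)
  }

_⊆ᵍ_ : ∀ {k n} → Graph k → Graph n → Set
_⊆ᵍ_ {k} {n} H G =
  Σ (Fin k → Fin n) λ f → Injective _≡_ _≡_ f ×
    (∀ i j → adj H i j ≡ true → adj G (f i) (f j) ≡ true)

_-free_ : ∀ {k n} → Graph n → Graph k → Set
G -free F = ¬ (F ⊆ᵍ G)

_≅_ : ∀ {n} → Graph n → Graph n → Set
_≅_ {n} G H =
  Σ (Fin n → Fin n) λ f → Bijective _≡_ _≡_ f ×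
    (∀ i j → adj G i j ≡ adj H (f i) (f j))

-- B_{r,s}: two copies of K_r sharing exactly s vertices, on vertex set Fin (2r - s).
-- Vertex v lies in the first copy iff v < r, in the second iff v ≥ r - s.
B : (r s : ℕ) → Graph ((r + r) ∸ s)
B r s = mkGraph body λ i j →
  Relation.Binary.PropositionalEquality.cong₂ _∨_ (∧-comm (inA i) (inA j)) (∧-comm (inB i) (inB j))
  where
    inA : Fin ((r + r) ∸ s) → Bool
    inA v = toℕ v <ᵇ r
    inB : Fin ((r + r) ∸ s) → Bool
    inB v = not (toℕ v <ᵇ (r ∸ s))
    body : Fin ((r + r) ∸ s) → Fin ((r + r) ∸ s) → Bool
    body i j = (inA i ∧ inA j) ∨ (inB i ∧ inB j)

isK4 : ∀ {n} → Graph n → Fin n → Fin n → Fin n → Fin n → Bool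
isK4 G a b c d =
  ⌊ a <? b ⌋ ∧ ⌊ b <? c ⌋ ∧ ⌊ c <? d ⌋ ∧
  adj G a b ∧ adj G a c ∧ adj G a d ∧ adj G b c ∧ adj G b d ∧ adj G c d

numK4 : ∀ {n} → Graph n → ℕ
numK4 {n} G =
  sum (map (λ a → sum (map (λ b → sum (map (λ c → sum (map (λ d →
    if isK4 G a b c d then 1 else 0) (allFin n))) (allFin n))) (allFin n))) (allFin n))

-- K_2 ∨ T_2(n-2) on Fin n: vertices 0,1 form the K_2; a vertex v ≥ 2 lies in
-- part (v mod 2) of the balanced complete bipartite graph T_2(n-2).
private
  xorᵇ : Bool → Bool → Bool
  xorᵇ a b = not (a ∧ b) ∧ (a ∨ b)

  xor-comm : ∀ a b → xorᵇ a b ≡ xorᵇ b a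
  xor-comm false false = refl
  xor-comm false true  = refl
  xor-comm true  false = refl
  xor-comm true  true  = refl


K2∨T2 : (n : ℕ) → Graph n
K2∨T2 n = mkGraph body bsym
  where
    small : Fin n → Bool
    small v = toℕ v <ᵇ 2
    part : Fin n → Bool
    part v = (toℕ v % 2) ≡ᵇ 0
    body : Fin n → Fin n → Bool
    body i j = small i ∨ small j ∨ xorᵇ (part i) (part j)
    bsym : ∀ i j → body i j ≡ body j i
    bsym i j with small i | small j
    ... | true  | true  = refl
    ... | true  | false = refl
    ... | false | true  = refl
    ... | false | false = xor-comm (part i) (part j)

{-# OPTIONS --safe #-}
module Submission where

open import Defs
open import Data.Bool using (Bool; true; false; not; if_then_else_; _∧_; _∨_)
import Data.Bool.Properties as Bool
open import Data.Empty using (⊥; ⊥-elim)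
open import Data.Fin using (Fin; zero; suc; #_; toℕ; fromℕ<; inject₁; _≟_; _<?_) renaming (_<_ to _<ᶠ_)
import Data.Fin.Properties as Fin
open import Data.Fin.Subset using (Subset; ⁅_⁆; ⋃; _∪_) renaming (_∈_ to _∈ˢ_; _∉_ to _∉ˢ_)
import Data.Fin.Subset.Properties as Sub
open import Data.List using (List; []; _∷_; [_]; _++_; length; map; filter; concatMap; allFin; take; tabulate; lookup; replicate; cartesianProduct)
open import Data.List.Membership.Propositional using (_∈_; _∉_; find; lose)
open import Data.List.Membership.Propositional.Properties
import Data.List.Properties as List
open import Data.List.Relation.Binary.Permutation.Propositional using (_↭_; ↭-refl; ↭-trans; ↭-sym; ↭-swap; prep; ↭⇒↭ₛ)
import Data.List.Relation.Binary.Permutation.Propositional.Properties as Perm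
import Data.List.Relation.Binary.Permutation.Setoid.Properties as PermS
open import Data.List.Relation.Binary.Subset.Propositional using (_⊆_)
open import Data.List.Relation.Unary.All as All using (All; []; _∷_)
import Data.List.Relation.Unary.All.Properties as AllP
open import Data.List.Relation.Unary.AllPairs as AllPairs using (AllPairs; []; _∷_)
import Data.List.Relation.Unary.AllPairs.Properties as AllPairsP
open import Data.List.Relation.Unary.Any using (Any; here; there; any?)
open import Data.List.Relation.Unary.Linked.Properties using (Linked⇒AllPairs)
open import Data.List.Relation.Unary.Unique.Propositional using (Unique)
import Data.List.Relation.Unary.Unique.Propositional.Properties as Unique
open import Data.Nat using (ℕ; zero; suc; _+_; _*_; _∸_; _≤_; _<_; _≥_; _/_; _%_; _≡ᵇ_; _<ᵇ_; ⌊_/2⌋; ⌈_/2⌉; >-nonZero; z≤n; s≤s)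
open import Data.Nat.DivMod using (m*n/n≡m; m/n*n≤m; m<n*o⇒m/o<n; /-monoˡ-≤)
open import Data.Nat.ListAction using (sum)
import Data.Nat.Properties as ℕ
open import Data.List.Extrema ℕ.≤-totalOrder using (argmax; argmax-all; f[xs]≤f[argmax])
open import Data.Nat.Tactic.RingSolver using (solve-∀)
open import Data.Product using (Σ; ∃; ∃₂; _×_; _,_; proj₁; proj₂)
open import Data.Sum as Sum using (_⊎_; inj₁; inj₂)
open import Function using (_∘_; id; case_of_)
open import Function.Definitions using (Bijective)
open import Relation.Binary.Definitions using (Symmetric; tri<; tri≈; tri>)
open import Relation.Binary.PropositionalEquality using (_≡_; _≢_; refl; sym; trans; cong; cong₂; subst; subst₂; setoid; ≢-sym; module ≡-Reasoning)
open import Relation.Nullary using (¬_; Dec; yes; no; contradiction)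
open import Relation.Nullary.Decidable using (_×-dec_; _⊎-dec_; _→-dec_; ¬?; ⌊_⌋)
open import Relation.Unary using (Decidable)

-- Two copies of K₄ in a B₄,₁-free graph that share a vertex share at least two.  Call a pair uv
-- solid if every K₄ containing u or v contains both.  Peel off small vertex sets R that meet at
-- most (n − 2)²|R| / 4n copies of K₄: a vertex in at most ten copies; a whole copy, met by at most
-- 39, if no pair is solid; or a solid pair uv together with all vertices having at least two
-- neighbours in its link (if there are none, uv or an edge of its link is a solid pair in at most
-- n/4 copies).  The link is triangle-free, because a triangle in it would give a K₄
-- containing u but not v; charging its edges to the vertices outside a largest neighbourhood
-- (Mantel) bounds their number.  Each bound is strict by more than the rounding error unless R is
-- the whole vertex set, and then equality in Mantel's bound forces K₂ ∨ T₂(n − 2).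

-- The bound (a - 2)²/4 fails for small numbers a of vertices: K₆ has 15 copies of K₄ and is too
-- small to contain B₄,₁. So an induction on the order of the graph has no place to start. Instead
-- `n` stays fixed, and the induction proves a bound linear in the number of vertices still in use,
-- at the rate (n - 2)²/4n per vertex; deleted vertices stay as isolated ones. Every peeled set is
-- measured against this one rate. Peeling the vertices in at most ten copies is what yields solid
-- pairs: once every vertex of a copy lies in more than ten, a triple contained in at least four
-- copies contains a solid pair. Without solid pairs every triple lies in at most three copies, and
-- the copies meeting a given one are bounded by a constant. The rounding error: (n - 2)² exceeds
-- 4⌊(n - 2)²/4⌋ by at most 1. Multiplied by n this is the summand `n` on the left of every estimate
-- named `gain`.

-- Counting by covering lists

module _ {A : Set} where

  extract : ∀ {xs ys : List A} → Unique xs → xs ⊆ ys → ∃ λ zs → ys ↭ xs ++ zs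
  extract {ys = ys} [] _ = ys , ↭-refl
  extract {x ∷ xs} (x∉xs ∷ uxs) sub with ∈-∃++ (sub (here refl))
  ... | as , bs , refl =
    let zs , p = extract uxs rest in zs , ↭-trans (Perm.shift x as bs) (prep x p)
    where
    rest : xs ⊆ as ++ bs
    rest y∈xs with ∈-++⁻ as (sub (there y∈xs))
    ... | inj₁ y∈as = ∈-++⁺ˡ y∈as
    ... | inj₂ (here refl) = contradiction refl (All.lookup x∉xs y∈xs)
    ... | inj₂ (there y∈bs) = ∈-++⁺ʳ as y∈bs

  length-⊆ : ∀ {xs ys : List A} → Unique xs → xs ⊆ ys → length xs ≤ length ys
  length-⊆ {xs} {ys} uxs sub with extract uxs sub
  ... | zs , p = begin
    length xs              ≤⟨ ℕ.m≤m+n _ _ ⟩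
    length xs + length zs  ≡⟨ List.length-++ xs ⟨
    length (xs ++ zs)      ≡⟨ Perm.↭-length p ⟨
    length ys              ∎
    where open ℕ.≤-Reasoning

  -- An upper bound witnessed by a covering list, which may repeat entries or contain non-solutions.
  -- Unions and images therefore need no decidability; distinctness enters only on the other side,
  -- in `few-length`.
  Few : ℕ → (A → Set) → Set
  Few k P = Σ (List A) λ xs → length xs ≤ k × (∀ {x} → P x → x ∈ xs)

  few-length : ∀ {k P xs} → Few k P → Unique xs → (∀ {x} → x ∈ xs → P x) → length xs ≤ k
  few-length (ys , ≤k , cover) uxs all = ℕ.≤-trans (length-⊆ uxs (cover ∘ all)) ≤k

  few-∅ : ∀ {P} → (∀ {x} → ¬ P x) → Few 0 P
  few-∅ none = [] , z≤n , λ p → contradiction p none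

  few-list : ∀ {P} xs → (∀ {x} → P x → x ∈ xs) → Few (length xs) P
  few-list xs cover = xs , ℕ.≤-refl , cover

  few-mono : ∀ {j k P Q} → j ≤ k → (∀ {x} → Q x → P x) → Few j P → Few k Q
  few-mono j≤k Q⇒P (xs , ≤j , cover) = xs , ℕ.≤-trans ≤j j≤k , cover ∘ Q⇒P

  few-∪ : ∀ {j k P Q R} → Few j P → Few k Q → (∀ {x} → R x → P x ⊎ Q x) → Few (j + k) R
  few-∪ (xs , ≤j , cx) (ys , ≤k , cy) split =
    xs ++ ys ,
    ℕ.≤-trans (ℕ.≤-reflexive (List.length-++ xs)) (ℕ.+-mono-≤ ≤j ≤k) ,
    Sum.[ ∈-++⁺ˡ ∘ cx , ∈-++⁺ʳ xs ∘ cy ] ∘ split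

  few-⋃ : ∀ {I : Set} {is : List I} (f : I → ℕ) {P : I → A → Set} {R} →
          (∀ {i} → i ∈ is → Few (f i) (P i)) →
          (∀ {x} → R x → ∃ λ i → i ∈ is × P i x) → Few (sum (map f is)) R
  few-⋃ {is = []} f few split = few-∅ λ r → case split r of λ ()
  few-⋃ {is = i ∷ is} f {P} few split =
    few-∪ (few (here refl)) (few-⋃ {is = is} f (few ∘ there) id) λ r → case split r of λ
      { (_ , here refl , p) → inj₁ p ; (j , there j∈ , p) → inj₂ (j , j∈ , p) }

few-map : ∀ {A B : Set} {k} {P : A → Set} {Q : B → Set} (f : A → B) →
          (∀ {y} → Q y → ∃ λ x → P x × y ≡ f x) → Few k P → Few k Q
few-map f preimage (xs , ≤k , cover) =
  map f xs , ℕ.≤-trans (ℕ.≤-reflexive (List.length-map f xs)) ≤k ,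
  λ q → case preimage q of λ { (x , p , refl) → ∈-map⁺ f (cover p) }

Many : ∀ {A : Set} → ℕ → (A → Set) → Set
Many {A} k P = Σ (List A) λ xs → length xs ≡ k × Unique xs × (∀ {x} → x ∈ xs → P x)

few-many : ∀ {A : Set} {j k} {P : A → Set} → Few j P → Many k P → k ≤ j
few-many few (xs , refl , uxs , all) = few-length few uxs all

module _ {n} {P : Fin n → Set} (P? : Decidable P) where

  enum : List (Fin n)
  enum = filter P? (allFin n)

  enum-unique : Unique enum
  enum-unique = Unique.filter⁺ P? (Unique.allFin⁺ n)

  ∈-enum⁺ : ∀ {x} → P x → x ∈ enum
  ∈-enum⁺ = ∈-filter⁺ P? (∈-allFin _)

  ∈-enum⁻ : ∀ {x} → x ∈ enum → P x
  ∈-enum⁻ = proj₂ ∘ ∈-filter⁻ P? {xs = allFin n}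

  card : ℕ
  card = length enum

  few-card : Few card P
  few-card = few-list enum ∈-enum⁺

  few-or-many : ∀ k → Few k P ⊎ Many (suc k) P
  few-or-many k with ℕ.≤-<-connex card k
  ... | inj₁ ≤k = inj₁ (enum , ≤k , ∈-enum⁺)
  ... | inj₂ k< = inj₂ (take (suc k) enum , trans (List.length-take (suc k) enum) (ℕ.m≤n⇒m⊓n≡m k<) ,
                         Unique.take⁺ (suc k) enum-unique , ∈-enum⁻ ∘ ∈-take)
    where
    ∈-take : ∀ {x} → x ∈ take (suc k) enum → x ∈ enum
    ∈-take {x} x∈ = subst (x ∈_) (List.take++drop≡id (suc k) enum) (∈-++⁺ˡ x∈)

-- Copies of K₄ as vertex sets

allPairs-↭ : ∀ {A : Set} {R : A → A → Set} → Symmetric R → ∀ {xs ys} → xs ↭ ys → AllPairs R xs → AllPairs R ys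
allPairs-↭ {A} R-sym p =
  PermS.AllPairs-resp-↭ (setoid A) R-sym ((λ { refl → id }) , λ { refl → id }) (↭⇒↭ₛ p)

unique-↭⁺ : ∀ {A : Set} {xs ys : List A} → xs ↭ ys → Unique xs → Unique ys
unique-↭⁺ = allPairs-↭ ≢-sym

-- As a vertex set a copy of K₄ has one name, however its vertices are listed; the strictly
-- increasing lists serve as canonical representatives.
⟪_⟫ : ∀ {n} → List (Fin n) → Subset n
⟪ xs ⟫ = ⋃ (map ⁅_⁆ xs)

∈⟪⟫⁺ : ∀ {n} {x : Fin n} {xs} → x ∈ xs → x ∈ˢ ⟪ xs ⟫
∈⟪⟫⁺ (here refl) = Sub.x∈p∪q⁺ (inj₁ (Sub.x∈⁅x⁆ _))
∈⟪⟫⁺ (there x∈) = Sub.x∈p∪q⁺ (inj₂ (∈⟪⟫⁺ x∈))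

∈⟪⟫⁻ : ∀ {n} {x : Fin n} xs → x ∈ˢ ⟪ xs ⟫ → x ∈ xs
∈⟪⟫⁻ [] x∈ = contradiction x∈ Sub.∉⊥
∈⟪⟫⁻ (y ∷ ys) x∈ with Sub.x∈p∪q⁻ ⁅ y ⁆ ⟪ ys ⟫ x∈
... | inj₁ x∈y = here (Sub.x∈⁅y⁆⇒x≡y y x∈y)
... | inj₂ x∈ys = there (∈⟪⟫⁻ ys x∈ys)

⟪⟫-cong : ∀ {n} {xs ys : List (Fin n)} → xs ↭ ys → ⟪ xs ⟫ ≡ ⟪ ys ⟫
⟪⟫-cong {xs = xs} {ys} p = Sub.⊆-antisym
  (∈⟪⟫⁺ ∘ Perm.∈-resp-↭ p ∘ ∈⟪⟫⁻ xs) (∈⟪⟫⁺ ∘ Perm.∈-resp-↭ (↭-sym p) ∘ ∈⟪⟫⁻ ys)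

⟪⟫-comm : ∀ {n} (x y : Fin n) → ⟪ x ∷ y ∷ [] ⟫ ≡ ⟪ y ∷ x ∷ [] ⟫
⟪⟫-comm x y = ⟪⟫-cong {xs = x ∷ y ∷ []} {ys = y ∷ x ∷ []} (↭-swap x y ↭-refl)

Increasing : ∀ {n} → List (Fin n) → Set
Increasing = AllPairs _<ᶠ_

increasing-ext : ∀ {n} {xs ys : List (Fin n)} → Increasing xs → Increasing ys →
                 xs ⊆ ys → ys ⊆ xs → xs ≡ ys
increasing-ext [] [] _ _ = refl
increasing-ext [] (_ ∷ _) _ sup = case sup (here refl) of λ ()
increasing-ext (_ ∷ _) [] sub _ = case sub (here refl) of λ ()
increasing-ext {xs = x ∷ xs} {y ∷ ys} (x< ∷ ixs) (y< ∷ iys) sub sup with sub (here refl) | sup (here refl)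
... | there x∈ys | there y∈xs = contradiction (All.lookup x< y∈xs) (ℕ.<-asym (All.lookup y< x∈ys))
... | there x∈ys | here refl = contradiction (All.lookup y< x∈ys) (ℕ.<-irrefl refl)
... | here refl | _ = cong (x ∷_) (increasing-ext ixs iys (tail x< sub) (tail y< sup))
  where
  tail : ∀ {as bs} → All (x <ᶠ_) as → x ∷ as ⊆ x ∷ bs → as ⊆ bs
  tail x<as s z∈ with s (there z∈)
  ... | here refl = contradiction (All.lookup x<as z∈) (ℕ.<-irrefl refl)
  ... | there z∈bs = z∈bs

⟪⟫-injective : ∀ {n} {xs ys : List (Fin n)} → Increasing xs → Increasing ys → ⟪ xs ⟫ ≡ ⟪ ys ⟫ → xs ≡ ys
⟪⟫-injective {xs = xs} {ys} ixs iys eq = increasing-ext ixs iys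
  (λ x∈ → ∈⟪⟫⁻ ys (subst (_ ∈ˢ_) eq (∈⟪⟫⁺ x∈))) (λ y∈ → ∈⟪⟫⁻ xs (subst (_ ∈ˢ_) (sym eq) (∈⟪⟫⁺ y∈)))

sort-increasing : ∀ {n} {xs : List (Fin n)} → Unique xs → ∃ λ ys → ys ↭ xs × Increasing ys
sort-increasing {n} {xs} uxs =
  sort xs , sort-↭ xs ,
  AllPairs.zipWith (λ (x≤y , x≢y) → ℕ.≤∧≢⇒< x≤y (x≢y ∘ Fin.toℕ-injective))
    (Linked⇒AllPairs ℕ.≤-trans (sort-↗ xs) ,
     unique-↭⁺ (↭-sym (sort-↭ xs)) uxs)
  where
  open import Data.List.Sort (Fin.≤-decTotalOrder n)

concatMap-unique : ∀ {A B : Set} (f : A → List B) {xs} → Unique xs →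
  (∀ x → Unique (f x)) → (∀ x x′ {y} → y ∈ f x → y ∈ f x′ → x ≡ x′) → Unique (concatMap f xs)
concatMap-unique f {[]} _ _ _ = []
concatMap-unique f {x ∷ xs} (x∉xs ∷ uxs) uf det =
  Unique.++⁺ (uf x) (concatMap-unique f uxs uf det) λ (y∈fx , y∈rest) →
    case find (∈-concatMap⁻ f y∈rest) of λ (x′ , x′∈xs , y∈fx′) →
      All.lookup x∉xs x′∈xs (det x x′ y∈fx y∈fx′)

sum-length : ∀ {A B : Set} (f : A → List B) {g : A → ℕ} → (∀ x → g x ≡ length (f x)) →
             ∀ xs → sum (map g xs) ≡ length (concatMap f xs)
sum-length f g≡ [] = refl
sum-length f g≡ (x ∷ xs) = trans (cong₂ _+_ (g≡ x) (sum-length f g≡ xs)) (sym (List.length-++ (f x)))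

⟪_⨾_⨾_⨾_⟫ : ∀ {n} (a b c d : Fin n) → Subset n
⟪ a ⨾ b ⨾ c ⨾ d ⟫ = ⟪ a ∷ b ∷ c ∷ d ∷ [] ⟫

module Cliques {n} (G : Graph n) where

  infix 4 _~_
  _~_ : Fin n → Fin n → Set
  x ~ y = adj G x y ≡ true

  ~-sym : ∀ {x y} → x ~ y → y ~ x
  ~-sym {x} {y} = trans (adj-sym G y x)

  ~⇒≢ : ∀ {x y} → x ~ y → x ≢ y
  ~⇒≢ {x} x~x refl = case trans (sym x~x) (adj-irrefl G x) of λ ()

  Complete : List (Fin n) → Set
  Complete = AllPairs _~_

  complete-↭ : ∀ {xs ys} → xs ↭ ys → Complete xs → Complete ys
  complete-↭ = allPairs-↭ ~-sym

  complete-unique : ∀ {xs} → Complete xs → Unique xs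
  complete-unique = AllPairs.map ~⇒≢

  record Clique (p : Subset n) : Set where
    constructor clique
    field
      vertices : List (Fin n)
      four     : length vertices ≡ 4
      complete : Complete vertices
      p≡       : p ≡ ⟪ vertices ⟫

  -- The nested `concatMap` built on this repeats the nested sums of `numK4`, so that `numK4≡length`
  -- can compare them level by level.
  quad : (a b c d : Fin n) → List (Subset n)
  quad a b c d = if isK4 G a b c d then [ ⟪ a ∷ b ∷ c ∷ d ∷ [] ⟫ ] else []

  cliques₃ : (a b c : Fin n) → List (Subset n)
  cliques₃ a b c = concatMap (quad a b c) (allFin n)

  cliques₂ : (a b : Fin n) → List (Subset n)
  cliques₂ a b = concatMap (cliques₃ a b) (allFin n)

  cliques₁ : Fin n → List (Subset n)
  cliques₁ a = concatMap (cliques₂ a) (allFin n)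

  cliques : List (Subset n)
  cliques = concatMap cliques₁ (allFin n)

  numK4≡length : numK4 G ≡ length cliques
  numK4≡length =
    sum-length cliques₁ (λ a → sum-length (cliques₂ a) (λ b → sum-length (cliques₃ a b) (λ c →
      sum-length (quad a b c) (λ d → if-length (isK4 G a b c d)) (allFin n)) (allFin n)) (allFin n)) (allFin n)
    where
    if-length : ∀ b {s : Subset n} → (if b then 1 else 0) ≡ length (if b then [ s ] else [])
    if-length true = refl
    if-length false = refl

  private
    ∧-true : ∀ {a b} → a ∧ b ≡ true → a ≡ true × b ≡ true
    ∧-true {true} {true} _ = refl , refl

    ∧-intro : ∀ {a b} → a ≡ true → b ≡ true → a ∧ b ≡ true
    ∧-intro refl refl = refl

    ⌊⌋-true : ∀ {P : Set} (d : Dec P) → ⌊ d ⌋ ≡ true → P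
    ⌊⌋-true (yes p) _ = p

    true-⌊⌋ : ∀ {P : Set} (d : Dec P) → P → ⌊ d ⌋ ≡ true
    true-⌊⌋ (yes _) _ = refl
    true-⌊⌋ (no ¬p) p = contradiction p ¬p

  quad⁻ : ∀ a b c d {p} → p ∈ quad a b c d →
          p ≡ ⟪ a ∷ b ∷ c ∷ d ∷ [] ⟫ × Increasing (a ∷ b ∷ c ∷ d ∷ []) × Complete (a ∷ b ∷ c ∷ d ∷ [])
  quad⁻ a b c d p∈ with isK4 G a b c d in eq
  quad⁻ a b c d (here refl) | true =
    let a<b , eq = ∧-true eq; b<c , eq = ∧-true eq; c<d , eq = ∧-true eq
        ab , eq = ∧-true eq; ac , eq = ∧-true eq; ad , eq = ∧-true eq
        bc , eq = ∧-true eq; bd , cd = ∧-true eq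
        a<b = ⌊⌋-true (a <? b) a<b; b<c = ⌊⌋-true (b <? c) b<c; c<d = ⌊⌋-true (c <? d) c<d
        b<d = ℕ.<-trans b<c c<d
    in refl ,
       (a<b ∷ ℕ.<-trans a<b b<c ∷ ℕ.<-trans a<b b<d ∷ []) ∷ (b<c ∷ b<d ∷ []) ∷ (c<d ∷ []) ∷ [] ∷ [] ,
       (ab ∷ ac ∷ ad ∷ []) ∷ (bc ∷ bd ∷ []) ∷ (cd ∷ []) ∷ [] ∷ []

  quad⁺ : ∀ {a b c d} → Increasing (a ∷ b ∷ c ∷ d ∷ []) → Complete (a ∷ b ∷ c ∷ d ∷ []) →
          ⟪ a ∷ b ∷ c ∷ d ∷ [] ⟫ ∈ quad a b c d
  quad⁺ {a} {b} {c} {d} ((a<b ∷ _ ∷ _ ∷ []) ∷ (b<c ∷ _ ∷ []) ∷ (c<d ∷ []) ∷ [] ∷ [])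
    ((ab ∷ ac ∷ ad ∷ []) ∷ (bc ∷ bd ∷ []) ∷ (cd ∷ []) ∷ [] ∷ [])
    rewrite ∧-intro (true-⌊⌋ (a <? b) a<b) (∧-intro (true-⌊⌋ (b <? c) b<c) (∧-intro (true-⌊⌋ (c <? d) c<d)
      (∧-intro ab (∧-intro ac (∧-intro ad (∧-intro bc (∧-intro bd cd))))))) = here refl

  private
    found : (f : Fin n → List (Subset n)) → ∀ {y} → y ∈ concatMap f (allFin n) → ∃ λ x → y ∈ f x
    found f y∈ = let x , _ , y∈fx = find (∈-concatMap⁻ f {xs = allFin n} y∈) in x , y∈fx

    insert : (f : Fin n → List (Subset n)) → ∀ {x y} → y ∈ f x → y ∈ concatMap f (allFin n)
    insert f y∈ = ∈-concatMap⁺ f (lose (∈-allFin _) y∈)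

    Spans : List (Fin n) → Subset n → Set
    Spans xs p = Complete xs × Increasing xs × p ≡ ⟪ xs ⟫

    Extends : List (Fin n) → Subset n → Set
    Extends xs p = ∃ λ ys → length (xs ++ ys) ≡ 4 × Spans (xs ++ ys) p

    quad-spans : ∀ a b c d {p} → p ∈ quad a b c d → Spans (a ∷ b ∷ c ∷ d ∷ []) p
    quad-spans a b c d p∈ = let p≡ , inc , comp = quad⁻ a b c d p∈ in comp , inc , p≡

    cliques₃-extends : ∀ a b c {p} → p ∈ cliques₃ a b c → Extends (a ∷ b ∷ c ∷ []) p
    cliques₃-extends a b c p∈ = let d , p∈ = found (quad a b c) p∈ in _ , refl , quad-spans a b c d p∈

    cliques₂-extends : ∀ a b {p} → p ∈ cliques₂ a b → Extends (a ∷ b ∷ []) p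
    cliques₂-extends a b p∈ =
      let c , p∈ = found (cliques₃ a b) p∈; ys , ext = cliques₃-extends a b c p∈ in c ∷ ys , ext

    cliques₁-extends : ∀ a {p} → p ∈ cliques₁ a → Extends (a ∷ []) p
    cliques₁-extends a p∈ =
      let b , p∈ = found (cliques₂ a) p∈; ys , ext = cliques₂-extends a b p∈ in b ∷ ys , ext

    spans-det : ∀ {p xs ys} → Spans xs p → Spans ys p → xs ≡ ys
    spans-det (_ , ixs , p≡) (_ , iys , p≡′) = ⟪⟫-injective ixs iys (trans (sym p≡) p≡′)

    -- Branches of the enumeration that reach the same set have the same increasing list, so they
    -- cannot differ in their prefixes.
    extends-det : ∀ {p xs ys} → (e : Extends xs p) (e′ : Extends ys p) → xs ++ proj₁ e ≡ ys ++ proj₁ e′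
    extends-det {p} {xs} {ys} (zs , _ , s) (zs′ , _ , s′) = spans-det {p} {xs ++ zs} {ys ++ zs′} s s′

  cliques-unique : Unique cliques
  cliques-unique =
    concatMap-unique cliques₁ allU (λ a →
      concatMap-unique (cliques₂ a) allU (λ b →
        concatMap-unique (cliques₃ a b) allU (λ c →
          concatMap-unique (quad a b c) allU (λ d → quad-unique (isK4 G a b c d))
            (λ d d′ p∈ p∈′ → List.∷-injectiveˡ (List.∷-injectiveʳ (List.∷-injectiveʳ (List.∷-injectiveʳ
              (spans-det (quad-spans a b c d p∈) (quad-spans a b c d′ p∈′)))))))
          (λ c c′ p∈ p∈′ → List.∷-injectiveˡ (List.∷-injectiveʳ (List.∷-injectiveʳ
            (extends-det (cliques₃-extends a b c p∈) (cliques₃-extends a b c′ p∈′))))))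
        (λ b b′ p∈ p∈′ → List.∷-injectiveˡ (List.∷-injectiveʳ
          (extends-det (cliques₂-extends a b p∈) (cliques₂-extends a b′ p∈′)))))
      (λ a a′ p∈ p∈′ → List.∷-injectiveˡ
        (extends-det (cliques₁-extends a p∈) (cliques₁-extends a′ p∈′)))
    where
    allU = Unique.allFin⁺ n
    quad-unique : ∀ b {s : Subset n} → Unique (if b then [ s ] else [])
    quad-unique true = [] ∷ []
    quad-unique false = []

  ∈-cliques⁻ : ∀ {p} → p ∈ cliques → Clique p
  ∈-cliques⁻ p∈ =
    let a , p∈ = found cliques₁ p∈; xs , four , comp , _ , p≡ = cliques₁-extends a p∈ in
    clique (a ∷ xs) four comp p≡

  ∈-cliques⁺ : ∀ {p} → Clique p → p ∈ cliques
  ∈-cliques⁺ (clique xs four comp refl) with sort-increasing (complete-unique comp)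
  ... | ys , ys↭xs , inc with ys | ys↭xs | inc | trans (Perm.↭-length ys↭xs) four
  ... | a ∷ b ∷ c ∷ d ∷ [] | ys↭xs | inc | refl = subst (_∈ cliques) (⟪⟫-cong ys↭xs)
    (insert cliques₁ (insert (cliques₂ a) (insert (cliques₃ a b) (insert (quad a b c)
      (quad⁺ inc (complete-↭ (↭-sym ys↭xs) comp))))))

  numK4-≤ : ∀ {k} → Few k Clique → numK4 G ≤ k
  numK4-≤ few = ℕ.≤-trans (ℕ.≤-reflexive numK4≡length) (few-length few cliques-unique ∈-cliques⁻)

  numK4-≥ : ∀ {ps} → Unique ps → (∀ {p} → p ∈ ps → Clique p) → length ps ≤ numK4 G
  numK4-≥ ups all = ℕ.≤-trans (length-⊆ ups (∈-cliques⁺ ∘ all)) (ℕ.≤-reflexive (sym numK4≡length))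

  K₄ : (a b c d : Fin n) → Set
  K₄ a b c d = Complete (a ∷ b ∷ c ∷ d ∷ [])

  module _ {p} (cl : Clique p) where

    -- Chosen vertices of a copy can be moved to the front of its list; `through₁` to `through₃` are
    -- the cases of one, two and three of them.
    clique-extract : ∀ {xs} → Unique xs → (∀ {x} → x ∈ xs → x ∈ˢ p) →
                     ∃ λ ys → length (xs ++ ys) ≡ 4 × Complete (xs ++ ys) × p ≡ ⟪ xs ++ ys ⟫
    clique-extract uxs ⊆p =
      let clique vs four comp p≡ = cl
          ys , vs↭ = extract uxs (∈⟪⟫⁻ vs ∘ subst (_ ∈ˢ_) p≡ ∘ ⊆p) in
      ys , trans (sym (Perm.↭-length vs↭)) four , complete-↭ vs↭ comp , trans p≡ (⟪⟫-cong vs↭)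

    clique-≤4 : ∀ {xs} → Unique xs → (∀ {x} → x ∈ xs → x ∈ˢ p) → length xs ≤ 4
    clique-≤4 {xs} uxs ⊆p with clique-extract uxs ⊆p
    ... | ys , four , _ = begin
      length xs              ≤⟨ ℕ.m≤m+n _ _ ⟩
      length xs + length ys  ≡⟨ List.length-++ xs ⟨
      length (xs ++ ys)      ≡⟨ four ⟩
      4                      ∎
      where open ℕ.≤-Reasoning

    through₁ : ∀ {a} → a ∈ˢ p → ∃ λ b → ∃ λ c → ∃ λ d → K₄ a b c d × p ≡ ⟪ a ⨾ b ⨾ c ⨾ d ⟫
    through₁ {a} a∈ with clique-extract {a ∷ []} ([] ∷ []) (λ { (here refl) → a∈ })
    ... | b ∷ c ∷ d ∷ [] , _ , k = b , c , d , k

    through₂ : ∀ {a b} → a ∈ˢ p → b ∈ˢ p → a ≢ b → ∃ λ c → ∃ λ d → K₄ a b c d × p ≡ ⟪ a ⨾ b ⨾ c ⨾ d ⟫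
    through₂ {a} {b} a∈ b∈ a≢b
      with clique-extract {a ∷ b ∷ []} ((a≢b ∷ []) ∷ [] ∷ []) (λ { (here refl) → a∈ ; (there (here refl)) → b∈ })
    ... | c ∷ d ∷ [] , _ , k = c , d , k

    through₃ : ∀ {a b c} → a ∈ˢ p → b ∈ˢ p → c ∈ˢ p → a ≢ b → a ≢ c → b ≢ c →
               ∃ λ d → K₄ a b c d × p ≡ ⟪ a ⨾ b ⨾ c ⨾ d ⟫
    through₃ {a} {b} {c} a∈ b∈ c∈ a≢b a≢c b≢c
      with clique-extract {a ∷ b ∷ c ∷ []} ((a≢b ∷ a≢c ∷ []) ∷ (b≢c ∷ []) ∷ [] ∷ [])
             (λ { (here refl) → a∈ ; (there (here refl)) → b∈ ; (there (there (here refl))) → c∈ })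
    ... | d ∷ [] , _ , k = d , k

  K₄-clique : ∀ {a b c d} → K₄ a b c d → Clique ⟪ a ⨾ b ⨾ c ⨾ d ⟫
  K₄-clique k = clique _ refl k refl

  swap₁₂ : ∀ {a b c d} → K₄ a b c d → K₄ b a c d
  swap₁₂ ((ab ∷ ac ∷ ad ∷ []) ∷ (bc ∷ bd ∷ []) ∷ cds) = (~-sym ab ∷ bc ∷ bd ∷ []) ∷ (ac ∷ ad ∷ []) ∷ cds

  swap₂₃ : ∀ {a b c d} → K₄ a b c d → K₄ a c b d
  swap₂₃ ((ab ∷ ac ∷ ad ∷ []) ∷ (bc ∷ bd ∷ []) ∷ (cd ∷ []) ∷ [] ∷ []) =
    (ac ∷ ab ∷ ad ∷ []) ∷ (~-sym bc ∷ cd ∷ []) ∷ (bd ∷ []) ∷ [] ∷ []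

  swap₃₄ : ∀ {a b c d} → K₄ a b c d → K₄ a b d c
  swap₃₄ ((ab ∷ ac ∷ ad ∷ []) ∷ (bc ∷ bd ∷ []) ∷ (cd ∷ []) ∷ [] ∷ []) =
    (ab ∷ ad ∷ ac ∷ []) ∷ (bd ∷ bc ∷ []) ∷ (~-sym cd ∷ []) ∷ [] ∷ []

-- Consequences of containing no B₄,₁

module FreeCliques {n} (G : Graph n) (free : G -free B 4 1) where

  open Cliques G public

  meet : ∀ {a b c d b′ c′ d′} → K₄ a b c d → K₄ a b′ c′ d′ →
         ∃ λ x → x ∈ b ∷ c ∷ d ∷ [] × x ∈ b′ ∷ c′ ∷ d′ ∷ []
  meet {a} {b} {c} {d} {b′} {c′} {d′}
    k@((ab ∷ ac ∷ ad ∷ []) ∷ (bc ∷ bd ∷ []) ∷ (cd ∷ []) ∷ [] ∷ [])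
    k′@((ab′ ∷ ac′ ∷ ad′ ∷ []) ∷ (bc′ ∷ bd′ ∷ []) ∷ (cd′ ∷ []) ∷ [] ∷ [])
    with any? (λ x → any? (x ≟_) (b′ ∷ c′ ∷ d′ ∷ [])) (b ∷ c ∷ d ∷ [])
  ... | yes common = find common
  ... | no disjoint = ⊥-elim (free (f , injective , homo))
    where
    f : Fin 7 → Fin n
    -- Index 3, where `a` stands, is the only vertex of `B 4 1` in both copies: the indices up to 3
    -- form the first, those from 3 on the second.
    f = Data.List.lookup (b ∷ c ∷ d ∷ a ∷ b′ ∷ c′ ∷ d′ ∷ [])

    R : Fin 7 → Fin 7 → Set
    R i j = f i ≢ f j × (adj (B 4 1) i j ≡ true → f i ~ f j)

    adjacent : ∀ {x y} {Q : Set} → x ~ y → x ≢ y × (Q → x ~ y)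
    adjacent e = ~⇒≢ e , λ _ → e

    apart : ∀ {x y} → x ∈ b ∷ c ∷ d ∷ [] → y ∈ b′ ∷ c′ ∷ d′ ∷ [] → x ≢ y
    apart x∈ y∈ refl = disjoint (lose x∈ y∈)

    b∈ : b ∈ b ∷ c ∷ d ∷ []
    b∈ = here refl
    c∈ : c ∈ b ∷ c ∷ d ∷ []
    c∈ = there (here refl)
    d∈ : d ∈ b ∷ c ∷ d ∷ []
    d∈ = there (there (here refl))
    b∈′ : b′ ∈ b′ ∷ c′ ∷ d′ ∷ []
    b∈′ = here refl
    c∈′ : c′ ∈ b′ ∷ c′ ∷ d′ ∷ []
    c∈′ = there (here refl)
    d∈′ : d′ ∈ b′ ∷ c′ ∷ d′ ∷ []
    d∈′ = there (there (here refl))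

    -- At the nine pairs joining the two triangles the images differ by disjointness, and `λ ()`
    -- records that `B 4 1` has no edge there; all other pairs are edges.
    table : AllPairs R (allFin 7)
    table =
      (adjacent bc ∷ adjacent bd ∷ adjacent (~-sym ab) ∷
        (apart b∈ b∈′ , λ ()) ∷ (apart b∈ c∈′ , λ ()) ∷ (apart b∈ d∈′ , λ ()) ∷ []) ∷
      (adjacent cd ∷ adjacent (~-sym ac) ∷
        (apart c∈ b∈′ , λ ()) ∷ (apart c∈ c∈′ , λ ()) ∷ (apart c∈ d∈′ , λ ()) ∷ []) ∷
      (adjacent (~-sym ad) ∷
        (apart d∈ b∈′ , λ ()) ∷ (apart d∈ c∈′ , λ ()) ∷ (apart d∈ d∈′ , λ ()) ∷ []) ∷
      (adjacent ab′ ∷ adjacent ac′ ∷ adjacent ad′ ∷ []) ∷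
      (adjacent bc′ ∷ adjacent bd′ ∷ []) ∷ (adjacent cd′ ∷ []) ∷ [] ∷ []

    compare : ∀ i j → i ≡ j ⊎ R i j ⊎ R j i
    compare i j = ∈-AllPairs₂ table (∈-allFin i) (∈-allFin j)

    injective : ∀ {i j} → f i ≡ f j → i ≡ j
    injective {i} {j} eq with compare i j
    ... | inj₁ i≡j = i≡j
    ... | inj₂ (inj₁ (≢ij , _)) = contradiction eq ≢ij
    ... | inj₂ (inj₂ (≢ji , _)) = contradiction (sym eq) ≢ji

    homo : ∀ i j → adj (B 4 1) i j ≡ true → adj G (f i) (f j) ≡ true
    homo i j e with compare i j
    ... | inj₁ refl = case trans (sym e) (adj-irrefl (B 4 1) i) of λ ()
    ... | inj₂ (inj₁ (_ , h)) = h e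
    ... | inj₂ (inj₂ (_ , h)) = ~-sym (h (trans (adj-sym (B 4 1) j i) e))

  meet-twice : ∀ {p q} → Clique p → Clique q → ∀ {x} → x ∈ˢ p → x ∈ˢ q →
               ∃ λ y → y ≢ x × y ∈ˢ p × y ∈ˢ q
  meet-twice cp cq x∈p x∈q with through₁ cp x∈p | through₁ cq x∈q
  ... | _ , _ , _ , k , refl | _ , _ , _ , k′ , refl =
    let y , y∈ , y∈′ = meet k k′ in
    y , All.lookup (AllPairs.head (complete-unique k)) y∈ ∘ sym ,
    ∈⟪⟫⁺ (there y∈) , ∈⟪⟫⁺ (there y∈′)

module _ {A : Set} where

  many-mono : ∀ {k} {P Q : A → Set} → (∀ {x} → P x → Q x) → Many k P → Many k Q
  many-mono P⇒Q (xs , len , uxs , all) = xs , len , uxs , P⇒Q ∘ all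

  many-avoid : (∀ (x y : A) → Dec (x ≡ y)) → ∀ {k P} x → Many (suc (suc k)) P → ∃ λ y → P y × y ≢ x
  many-avoid _≟′_ x (y ∷ z ∷ _ , _ , (y≢z ∷ _) ∷ _ , all) with y ≟′ x
  ... | no y≢x = y , all (here refl) , y≢x
  ... | yes refl = z , all (there (here refl)) , ≢-sym y≢z

Disjoint₂ : ∀ {A : Set} → A × A → A × A → Set
Disjoint₂ (a , b) (c , d) = a ≢ c × a ≢ d × b ≢ c × b ≢ d

Matching : ∀ {A : Set} → List (A × A) → Set
Matching = AllPairs Disjoint₂

-- Heavy triples and solid pairs

module Solidity {n} (G : Graph n) (free : G -free B 4 1) where

  open FreeCliques G free public

  K₄? : ∀ a b c d → Dec (K₄ a b c d)
  K₄? a b c d = AllPairs.allPairs? (λ x y → adj G x y Bool.≟ true) (a ∷ b ∷ c ∷ d ∷ [])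

  module _ {a b c d} (_ : K₄ a b c d) where

    in₁ : a ∈ˢ ⟪ a ⨾ b ⨾ c ⨾ d ⟫
    in₁ = ∈⟪⟫⁺ {xs = a ∷ b ∷ c ∷ d ∷ []} (here refl)

    in₃ : c ∈ˢ ⟪ a ⨾ b ⨾ c ⨾ d ⟫
    in₃ = ∈⟪⟫⁺ {xs = a ∷ b ∷ c ∷ d ∷ []} (there (there (here refl)))

    in₄ : d ∈ˢ ⟪ a ⨾ b ⨾ c ⨾ d ⟫
    in₄ = ∈⟪⟫⁺ {xs = a ∷ b ∷ c ∷ d ∷ []} (there (there (there (here refl))))

    split : ∀ {x} → x ∈ˢ ⟪ a ⨾ b ⨾ c ⨾ d ⟫ → x ≡ a ⊎ x ≡ b ⊎ x ≡ c ⊎ x ≡ d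
    split x∈ with ∈⟪⟫⁻ (a ∷ b ∷ c ∷ d ∷ []) x∈
    ... | here eq = inj₁ eq
    ... | there (here eq) = inj₂ (inj₁ eq)
    ... | there (there (here eq)) = inj₂ (inj₂ (inj₁ eq))
    ... | there (there (there (here eq))) = inj₂ (inj₂ (inj₂ eq))

    avoids : ∀ {x} → x ≢ a → x ≢ b → x ≢ c → x ≢ d → x ∉ˢ ⟪ a ⨾ b ⨾ c ⨾ d ⟫
    avoids ≢a ≢b ≢c ≢d x∈ = Sum.[ ≢a , Sum.[ ≢b , Sum.[ ≢c , ≢d ] ] ] (split x∈)

  clique≡ : ∀ {a b c d p} → K₄ a b c d → Clique p → a ∈ˢ p → b ∈ˢ p → c ∈ˢ p → d ∈ˢ p → p ≡ ⟪ a ⨾ b ⨾ c ⨾ d ⟫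
  clique≡ ((ab ∷ ac ∷ ad ∷ []) ∷ (bc ∷ bd ∷ []) ∷ (cd ∷ []) ∷ _) cl a∈ b∈ c∈ d∈
    with through₃ cl a∈ b∈ c∈ (~⇒≢ ab) (~⇒≢ ac) (~⇒≢ bc)
  ... | z , k′ , refl with split k′ d∈
  ... | inj₁ refl = contradiction refl (~⇒≢ ad)
  ... | inj₂ (inj₁ refl) = contradiction refl (~⇒≢ bd)
  ... | inj₂ (inj₂ (inj₁ refl)) = contradiction refl (~⇒≢ cd)
  ... | inj₂ (inj₂ (inj₂ refl)) = refl

  Through : Fin n → Subset n → Set
  Through x p = Clique p × x ∈ˢ p

  Meets : List (Fin n) → Subset n → Set
  Meets xs p = Clique p × ∃ λ x → x ∈ xs × x ∈ˢ p

  -- The second common vertex given by `meet-twice` is neither `u` nor `v`. Most later exclusions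
  -- use freeness in this form.
  share : ∀ {p u v x y} → Clique p → K₄ u v x y → u ∈ˢ p → v ∉ˢ p → x ∈ˢ p ⊎ y ∈ˢ p
  share {u = u} {v} {x} {y} cl k u∈p v∉p with meet-twice cl (K₄-clique k) u∈p (in₁ k)
  ... | z , z≢u , z∈p , z∈k with split k z∈k
  ... | inj₁ refl = contradiction refl z≢u
  ... | inj₂ (inj₁ refl) = contradiction z∈p v∉p
  ... | inj₂ (inj₂ (inj₁ refl)) = inj₁ z∈p
  ... | inj₂ (inj₂ (inj₂ refl)) = inj₂ z∈p

  four-more : ∀ {p u ys} → Clique p → u ∈ˢ p → Unique ys → length ys ≡ 4 → (∀ {y} → y ∈ ys → y ∈ˢ p × u ≢ y) → ⊥
  four-more {ys = ys} cl u∈p uys len all = ℕ.<-irrefl refl (subst (λ k → suc k ≤ 4) len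
    (clique-≤4 cl (All.tabulate (proj₂ ∘ all) ∷ uys) λ { (here refl) → u∈p ; (there y∈) → proj₁ (all y∈) }))

  Solid : Fin n → Fin n → Set
  Solid u v = (∀ {p} → Clique p → u ∈ˢ p → v ∈ˢ p) × (∀ {p} → Clique p → v ∈ˢ p → u ∈ˢ p)

  Solid? : ∀ u v → Dec (Solid u v)
  Solid? u v with All.all? (λ p → (u Sub.∈? p) →-dec (v Sub.∈? p)) cliques
                | All.all? (λ p → (v Sub.∈? p) →-dec (u Sub.∈? p)) cliques
  ... | yes uv | yes vu = yes ((λ cl → All.lookup uv (∈-cliques⁺ cl)) , (λ cl → All.lookup vu (∈-cliques⁺ cl)))
  ... | no ¬uv | _ = no λ (uv , _) → ¬uv (All.tabulate (uv ∘ ∈-cliques⁻))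
  ... | _ | no ¬vu = no λ (_ , vu) → ¬vu (All.tabulate (vu ∘ ∈-cliques⁻))

  -- A clique containing u but not v meets each of the four disjoint link edges, so has five vertices.
  matching-solid : ∀ {u v} M → length M ≡ 4 → Matching M → (∀ {x y} → (x , y) ∈ M → K₄ u v x y) → Solid u v
  matching-solid {u} {v} M len disjoint edges = half edges , half (swap₁₂ ∘ edges)
    where
    half : ∀ {u v p} → (∀ {x y} → (x , y) ∈ M → K₄ u v x y) → Clique p → u ∈ˢ p → v ∈ˢ p
    half {u} {v} {p} edges cl u∈p with v Sub.∈? p
    ... | yes v∈p = v∈p
    ... | no v∉p = ⊥-elim (four-more cl u∈p unique (trans (List.length-map choose M) len) λ y∈ →
        case ∈-map⁻ choose y∈ of λ { (e , e∈ , refl) → chosen e∈ })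
      where
      choose : Fin n × Fin n → Fin n
      choose (x , y) with x Sub.∈? p
      ... | yes _ = x
      ... | no _ = y
      chosen : ∀ {e} → e ∈ M → choose e ∈ˢ p × u ≢ choose e
      chosen {x , y} e∈ with edges e∈
      ... | k@((_ ∷ ux ∷ uy ∷ []) ∷ _) with x Sub.∈? p | share cl k u∈p v∉p
      ... | yes x∈p | _ = x∈p , ~⇒≢ ux
      ... | no x∉p | inj₁ x∈p = contradiction x∈p x∉p
      ... | no _ | inj₂ y∈p = y∈p , ~⇒≢ uy
      choose-≢ : ∀ {e f} → Disjoint₂ e f → choose e ≢ choose f
      choose-≢ {a , b} {c , d} (ac , ad , bc , bd) with a Sub.∈? p | c Sub.∈? p
      ... | yes _ | yes _ = ac
      ... | yes _ | no _ = ad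
      ... | no _ | yes _ = bc
      ... | no _ | no _ = bd
      unique : Unique (map choose M)
      unique = AllPairsP.map⁺ (AllPairs.map choose-≢ disjoint)

  -- Four petals, because a copy through `u` has room for only three further vertices.
  Heavy : (u v x : Fin n) → Set
  Heavy u v x = Many 4 (K₄ u v x)

  heavy₁₂ : ∀ {u v x} → Heavy u v x → Heavy v u x
  heavy₁₂ = many-mono swap₁₂

  heavy₂₃ : ∀ {u v x} → Heavy u v x → Heavy u x v
  heavy₂₃ = many-mono swap₂₃

  -- If `p` missed `x` too, `share` would put all four petals into `p` beside `u`.
  heavy-hit : ∀ {u v x p} → Heavy u v x → Clique p → u ∈ˢ p → v ∉ˢ p → x ∈ˢ p
  heavy-hit {u} {v} {x} {p} (ys , len , uys , petals) cl u∈p v∉p with x Sub.∈? p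
  ... | yes x∈p = x∈p
  ... | no x∉p = ⊥-elim (four-more cl u∈p uys len petal∈)
    where
    petal∈ : ∀ {y} → y ∈ ys → y ∈ˢ p × u ≢ y
    petal∈ y∈ with petals y∈
    ... | k@((_ ∷ _ ∷ uy ∷ []) ∷ _) = Sum.[ (λ x∈p → contradiction x∈p x∉p) , id ] (share cl k u∈p v∉p) , ~⇒≢ uy

  few-triple : ∀ {k u v x} {P : Fin n → Set} {Q : Subset n → Set} → u ≢ v → u ≢ x → v ≢ x → Few k P →
    (∀ {p} → Q p → Clique p × u ∈ˢ p × v ∈ˢ p × x ∈ˢ p) →
    (∀ {z} → K₄ u v x z → Q ⟪ u ⨾ v ⨾ x ⨾ z ⟫ → P z) → Few k Q
  few-triple {u = u} {v} {x} {P} {Q} u≢v u≢x v≢x few contains petal = few-map (λ z → ⟪ u ⨾ v ⨾ x ⨾ z ⟫) preimage few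
    where
    preimage : ∀ {p} → Q p → ∃ λ z → P z × p ≡ ⟪ u ⨾ v ⨾ x ⨾ z ⟫
    preimage q with contains q
    ... | cl , u∈ , v∈ , x∈ with through₃ cl u∈ v∈ x∈ u≢v u≢x v≢x
    ... | z , k , refl = z , petal k q , refl

-- Heavy triples contain solid pairs

module MinDegree {n} (G : Graph n) (free : G -free B 4 1)
  (big : ∀ {p x} → Cliques.Clique G p → x ∈ˢ p → ¬ Few 10 (Solidity.Through G free x)) where

  open Solidity G free

  -- For a petal `y` of a heavy triple `u v x`, the copies through `y` that keep `u`, `v` and drop
  -- `x` are numerous. The pair that is kept is the type of the petal.
  Linked : (u v x y : Fin n) → Set
  Linked u v x y = Many 4 (λ z → K₄ u v y z × z ≢ x)

  -- A copy through `y` contains at least two of `u`, `v`, `x`: at least one by `share`, and exactly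
  -- one is excluded by `heavy-hit`. If each pair without the third vertex occurred in at most three
  -- copies, `y` would lie in at most 1 + 3 · 3 = 10, against `big`.
  petal-type : ∀ {u v x y} → Heavy u v x → K₄ u v x y → Linked u v x y ⊎ Linked u x v y ⊎ Linked v x u y
  petal-type {u} {v} {x} {y} heavy k@((uv ∷ ux ∷ uy ∷ []) ∷ (vx ∷ vy ∷ []) ∷ (xy ∷ []) ∷ _)
    with dichotomy u v x | dichotomy u x v | dichotomy v x u
    where
    dichotomy : ∀ u v x → Few 3 (λ z → K₄ u v y z × z ≢ x) ⊎ Linked u v x y
    dichotomy u v x = few-or-many (λ z → K₄? u v y z ×-dec ¬? (z ≟ x)) 3
  ... | inj₂ uv′ | _ | _ = inj₁ uv′
  ... | _ | inj₂ ux′ | _ = inj₂ (inj₁ ux′)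
  ... | _ | _ | inj₂ vx′ = inj₂ (inj₂ vx′)
  ... | inj₁ uv′ | inj₁ ux′ | inj₁ vx′ =
    ⊥-elim (big (K₄-clique k) (in₄ k)
      (few-∪ {P = λ p → p ≡ ⟪ u ⨾ v ⨾ x ⨾ y ⟫} (few-list (⟪ u ⨾ v ⨾ x ⨾ y ⟫ ∷ []) here)
        (few-∪ (pairs uv uy vy uv′) (few-∪ (pairs ux uy xy ux′) (pairs vx vy xy vx′) id) id) classify))
    where
    Pair : (u v x : Fin n) → Subset n → Set
    Pair u v x p = (Clique p × u ∈ˢ p × v ∈ˢ p × y ∈ˢ p) × x ∉ˢ p

    pairs : ∀ {u v x} → u ~ v → u ~ y → v ~ y → Few 3 (λ z → K₄ u v y z × z ≢ x) → Few 3 (Pair u v x)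
    pairs {u} {v} uv uy vy few = few-triple {u = u} {v} {y} (~⇒≢ uv) (~⇒≢ uy) (~⇒≢ vy) few proj₁
      λ k q → k , λ { refl → proj₂ q (in₄ k) }

    classify : ∀ {p} → Through y p → p ≡ ⟪ u ⨾ v ⨾ x ⨾ y ⟫ ⊎ Pair u v x p ⊎ Pair u x v p ⊎ Pair v x u p
    classify {p} (cl , y∈) with u Sub.∈? p | v Sub.∈? p | x Sub.∈? p
    ... | yes u∈ | yes v∈ | yes x∈ = inj₁ (clique≡ k cl u∈ v∈ x∈ y∈)
    ... | yes u∈ | yes v∈ | no x∉ = inj₂ (inj₁ ((cl , u∈ , v∈ , y∈) , x∉))
    ... | yes u∈ | no v∉ | yes x∈ = inj₂ (inj₂ (inj₁ ((cl , u∈ , x∈ , y∈) , v∉)))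
    ... | no u∉ | yes v∈ | yes x∈ = inj₂ (inj₂ (inj₂ ((cl , v∈ , x∈ , y∈) , u∉)))
    ... | yes u∈ | no v∉ | no x∉ = contradiction (heavy-hit heavy cl u∈ v∉) x∉
    ... | no u∉ | yes v∈ | no x∉ = contradiction (heavy-hit (heavy₁₂ heavy) cl v∈ u∉) x∉
    ... | no u∉ | no v∉ | yes x∈ = contradiction (heavy-hit (heavy₁₂ (heavy₂₃ heavy)) cl x∈ u∉) v∉
    ... | no u∉ | no v∉ | no x∉ with share cl (swap₁₂ (swap₂₃ (swap₃₄ k))) y∈ u∉
    ... | inj₁ v∈ = contradiction v∈ v∉
    ... | inj₂ x∈ = contradiction x∈ x∉

  linked-hit : ∀ {u v x y p} → Linked u v x y → Clique p → u ∈ˢ p → v ∉ˢ p → y ∈ˢ p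
  linked-hit linked = heavy-hit (many-mono proj₁ linked)

  -- If y is linked through uv and another petal y′ were linked through ux, some clique u x y′ z
  -- would avoid both v and y, against linked-hit.
  same-type : ∀ {u v x y y′} → K₄ u v x y → K₄ u v x y′ → y ≢ y′ → Linked u v x y → ¬ Linked u x v y′
  same-type {u} {v} {x} {y} {y′} ((uv ∷ ux ∷ uy ∷ []) ∷ (vx ∷ vy ∷ []) ∷ (xy ∷ []) ∷ _)
    ((_ ∷ _ ∷ _ ∷ []) ∷ (_ ∷ vy′ ∷ []) ∷ _) y≢y′ linked linked′ with many-avoid _≟_ y linked′
  ... | z , (k , z≢v) , z≢y =
    avoids k (≢-sym (~⇒≢ uy)) (≢-sym (~⇒≢ xy)) y≢y′ (≢-sym z≢y)
      (linked-hit linked (K₄-clique k) (in₁ k) (avoids k (≢-sym (~⇒≢ uv)) (~⇒≢ vx) (~⇒≢ vy′) (≢-sym z≢v)))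

  linked₁₂ : ∀ {u v x y} → Linked u v x y → Linked v u x y
  linked₁₂ = many-mono λ (k , z≢x) → swap₁₂ k , z≢x

  -- By `same-type` all petals have the type of `y`. A copy through `u` missing `v` would contain
  -- each of them by `linked-hit`, four vertices beside `u`.
  linked-solid : ∀ {u v x y} → Heavy u v x → K₄ u v x y → Linked u v x y → Solid u v
  linked-solid {u} {v} {x} {y} heavy@(ys , len , uys , petals) k linked =
    half petals all-linked , half (swap₁₂ ∘ petals) (linked₁₂ ∘ all-linked)
    where
    all-linked : ∀ {y′} → y′ ∈ ys → Linked u v x y′
    all-linked {y′} y′∈ with y ≟ y′
    ... | yes refl = linked
    ... | no y≢y′ with petal-type heavy (petals y′∈)
    ... | inj₁ uv′ = uv′
    ... | inj₂ (inj₁ ux′) = ⊥-elim (same-type k (petals y′∈) y≢y′ linked ux′)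
    ... | inj₂ (inj₂ vx′) = ⊥-elim (same-type (swap₁₂ k) (swap₁₂ (petals y′∈)) y≢y′ (linked₁₂ linked) vx′)

    half : ∀ {u v p} → (∀ {y} → y ∈ ys → K₄ u v x y) → (∀ {y} → y ∈ ys → Linked u v x y) → Clique p → u ∈ˢ p → v ∈ˢ p
    half {u} {v} {p} petals linked cl u∈p with v Sub.∈? p
    ... | yes v∈p = v∈p
    ... | no v∉p = ⊥-elim (four-more cl u∈p uys len λ y∈ → linked-hit (linked y∈) cl u∈p v∉p ,
                     (case petals y∈ of λ { ((_ ∷ _ ∷ uy ∷ []) ∷ _) → ~⇒≢ uy }))

  -- The type of a single petal names the solid pair.
  heavy-solid : ∀ {u v x} → Heavy u v x → Solid u v ⊎ Solid u x ⊎ Solid v x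
  heavy-solid heavy@(y ∷ _ , _ , _ , petals) with petals (here refl)
  ... | k with petal-type heavy k
  ... | inj₁ uv = inj₁ (linked-solid heavy k uv)
  ... | inj₂ (inj₁ ux) = inj₂ (inj₁ (linked-solid (heavy₂₃ heavy) (swap₂₃ k) ux))
  ... | inj₂ (inj₂ vx) = inj₂ (inj₂ (linked-solid (heavy₂₃ (heavy₁₂ heavy)) (swap₂₃ (swap₁₂ k)) vx))

-- Copies of K₄ meeting a given one

few-remove : ∀ {n k} {P : Fin n → Set} → Decidable P → Few (suc k) P → ∀ {y} → P y → Few k (λ z → P z × z ≢ y)
few-remove {k = k} P? few {y} py with few-or-many (λ z → P? z ×-dec ¬? (z ≟ y)) k
... | inj₁ few′ = few′
... | inj₂ (zs , len , uzs , all) = ⊥-elim (ℕ.<-irrefl refl (few-many few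
  (y ∷ zs , cong suc len , All.tabulate (λ z∈ → ≢-sym (proj₂ (all z∈))) ∷ uzs ,
   λ { (here refl) → py ; (there z∈) → proj₁ (all z∈) })))

some? : ∀ {n} {R : Fin n → Fin n → Set} → (∀ x y → Dec (R x y)) → Dec (∃₂ R)
some? R? = Fin.any? λ x → Fin.any? (R? x)

-- The edges of link(ab) avoiding c and d, for a K₄ abcd: a matching of three of them and cd make four.
record Light (n : ℕ) : Set₁ where
  field
    E      : Fin n → Fin n → Set
    E?     : ∀ x y → Dec (E x y)
    E-sym  : ∀ {x y} → E x y → E y x
    E-≢    : ∀ {x y} → E x y → x ≢ y
    degree : ∀ x → Few 3 (E x)
    thin   : ∀ M → length M ≡ 3 → Matching M → ¬ (∀ {x y} → (x , y) ∈ M → E x y)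

  Edge : Subset n → Set
  Edge s = ∃₂ λ x y → E x y × s ≡ ⟪ x ∷ y ∷ [] ⟫

  Star : Fin n → Subset n → Set
  Star x s = ∃ λ y → E x y × s ≡ ⟪ x ∷ y ∷ [] ⟫

  star : ∀ x → Few 3 (Star x)
  star x = few-map (λ y → ⟪ x ∷ y ∷ [] ⟫) id (degree x)

  starʳ : ∀ {x y s} → E x y → s ≡ ⟪ x ∷ y ∷ [] ⟫ → Star y s
  starʳ {x} {y} e s≡ = x , E-sym e , trans s≡ (⟪⟫-comm x y)

  Star∖ : Fin n → Fin n → Subset n → Set
  Star∖ x y s = ∃ λ z → (E x z × z ≢ y) × s ≡ ⟪ x ∷ z ∷ [] ⟫

  star∖ : ∀ {x y} → E x y → Few 2 (Star∖ x y)
  star∖ {x} e = few-map (λ z → ⟪ x ∷ z ∷ [] ⟫) id (few-remove (E? x) (degree x) e)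

  -- `p` and `q` form a vertex cover of the graph `E`.
  Hits : (p q : Fin n) → Set
  Hits p q = ∀ {x y} → E x y → x ∈ p ∷ q ∷ [] ⊎ y ∈ p ∷ q ∷ []

  hits-≤6 : ∀ {p q} → Hits p q → Few 6 Edge
  hits-≤6 {p} {q} hits = few-∪ (star p) (star q) λ (x , y , e , s≡) → classify e s≡ (hits e)
    where
    classify : ∀ {x y s} → E x y → s ≡ ⟪ x ∷ y ∷ [] ⟫ → x ∈ p ∷ q ∷ [] ⊎ y ∈ p ∷ q ∷ [] → Star p s ⊎ Star q s
    classify {y = y} e s≡ (inj₁ (here refl)) = inj₁ (y , e , s≡)
    classify {y = y} e s≡ (inj₁ (there (here refl))) = inj₂ (y , e , s≡)
    classify e s≡ (inj₂ (here refl)) = inj₁ (starʳ e s≡)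
    classify e s≡ (inj₂ (there (here refl))) = inj₂ (starʳ e s≡)

  _∈?_ : ∀ (x : Fin n) ys → Dec (x ∈ ys)
  x ∈? ys = any? (x ≟_) ys

  -- No three edges are disjoint, so at most two, `p q` and `r s`, meet all edges. Each of their
  -- four ends has at most two further edges, which gives 2 + 4 · 2; a single edge meeting all
  -- others leaves at most 6.
  edge-≤10 : Few 10 Edge
  edge-≤10 with some? E?
  ... | no none = few-mono z≤n id (few-∅ λ (x , y , e , _) → none (x , y , e))
  ... | yes (p , q , pq)
    with some? (λ r s → E? r s ×-dec ¬? (r ∈? (p ∷ q ∷ [])) ×-dec ¬? (s ∈? (p ∷ q ∷ [])))
  ... | no none = few-mono (ℕ.m≤m+n 6 4) id (hits-≤6 hits)
    where
    hits : Hits p q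
    hits {x} {y} e with x ∈? (p ∷ q ∷ []) | y ∈? (p ∷ q ∷ [])
    ... | yes x∈ | _ = inj₁ x∈
    ... | no _ | yes y∈ = inj₂ y∈
    ... | no x∉ | no y∉ = contradiction (x , y , e , x∉ , y∉) none
  ... | yes (r , s , rs , r∉ , s∉) =
    few-∪ (few-list (⟪ p ∷ q ∷ [] ⟫ ∷ ⟪ r ∷ s ∷ [] ⟫ ∷ []) id)
      (few-∪ (few-∪ (star∖ pq) (star∖ (E-sym pq)) id) (few-∪ (star∖ rs) (star∖ (E-sym rs)) id) id)
      λ (x , y , e , s≡) → classify e s≡
    where
    Piece : Subset n → Set
    Piece t = t ∈ ⟪ p ∷ q ∷ [] ⟫ ∷ ⟪ r ∷ s ∷ [] ⟫ ∷ [] ⊎ (Star∖ p q t ⊎ Star∖ q p t) ⊎ (Star∖ r s t ⊎ Star∖ s r t)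

    at : ∀ {x y t} → E x y → t ≡ ⟪ x ∷ y ∷ [] ⟫ → x ∈ p ∷ q ∷ r ∷ s ∷ [] → Piece t
    at {y = y} e t≡ (here refl) with y ≟ q
    ... | yes refl = inj₁ (here t≡)
    ... | no y≢q = inj₂ (inj₁ (inj₁ (y , (e , y≢q) , t≡)))
    at {y = y} e t≡ (there (here refl)) with y ≟ p
    ... | yes refl = inj₁ (here (trans t≡ (⟪⟫-comm q p)))
    ... | no y≢p = inj₂ (inj₁ (inj₂ (y , (e , y≢p) , t≡)))
    at {y = y} e t≡ (there (there (here refl))) with y ≟ s
    ... | yes refl = inj₁ (there (here t≡))
    ... | no y≢s = inj₂ (inj₂ (inj₁ (y , (e , y≢s) , t≡)))
    at {y = y} e t≡ (there (there (there (here refl)))) with y ≟ r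
    ... | yes refl = inj₁ (there (here (trans t≡ (⟪⟫-comm s r))))
    ... | no y≢r = inj₂ (inj₂ (inj₂ (y , (e , y≢r) , t≡)))

    classify : ∀ {x y t} → E x y → t ≡ ⟪ x ∷ y ∷ [] ⟫ → Piece t
    classify {x} {y} e t≡ with x ∈? (p ∷ q ∷ r ∷ s ∷ []) | y ∈? (p ∷ q ∷ r ∷ s ∷ [])
    ... | yes x∈ | _ = at e t≡ x∈
    ... | no _ | yes y∈ = at (E-sym e) (trans t≡ (⟪⟫-comm x y)) y∈
    ... | no x∉ | no y∉ = contradiction
      (λ { (here refl) → e ; (there (here refl)) → pq ; (there (there (here refl))) → rs })
      (thin ((x , y) ∷ (p , q) ∷ (r , s) ∷ []) refl
        ((apart x∉ y∉ (here refl) (there (here refl)) ∷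
          apart x∉ y∉ (there (there (here refl))) (there (there (there (here refl)))) ∷ []) ∷
         (((λ { refl → r∉ (here refl) }) , (λ { refl → s∉ (here refl) }) ,
           (λ { refl → r∉ (there (here refl)) }) , (λ { refl → s∉ (there (here refl)) })) ∷ []) ∷ [] ∷ []))
      where
      apart : ∀ {x y z w ys} → x ∉ ys → y ∉ ys → z ∈ ys → w ∈ ys → Disjoint₂ (x , y) (z , w)
      apart x∉ y∉ z∈ w∈ = (λ { refl → x∉ z∈ }) , (λ { refl → x∉ w∈ }) , (λ { refl → y∉ z∈ }) , (λ { refl → y∉ w∈ })

  -- An edge off `p` must have the ends `q` and `r`, so there is at most one beside the three at
  -- `p`.
  hits-path-≤4 : ∀ {p q r} → q ≢ r → Hits p q → Hits p r → Few 4 Edge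
  hits-path-≤4 {p} {q} {r} q≢r hits hits′ =
    few-∪ (star p) (few-list (⟪ q ∷ r ∷ [] ⟫ ∷ []) id) λ (x , y , e , s≡) → classify e s≡ (hits e) (hits′ e)
    where
    classify : ∀ {x y s} → E x y → s ≡ ⟪ x ∷ y ∷ [] ⟫ → x ∈ p ∷ q ∷ [] ⊎ y ∈ p ∷ q ∷ [] →
               x ∈ p ∷ r ∷ [] ⊎ y ∈ p ∷ r ∷ [] → Star p s ⊎ s ∈ ⟪ q ∷ r ∷ [] ⟫ ∷ []
    classify {y = y} e s≡ (inj₁ (here refl)) _ = inj₁ (y , e , s≡)
    classify e s≡ (inj₂ (here refl)) _ = inj₁ (starʳ e s≡)
    classify {y = y} e s≡ _ (inj₁ (here refl)) = inj₁ (y , e , s≡)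
    classify e s≡ _ (inj₂ (here refl)) = inj₁ (starʳ e s≡)
    classify e s≡ (inj₁ (there (here refl))) (inj₁ (there (here refl))) = contradiction refl q≢r
    classify e s≡ (inj₁ (there (here refl))) (inj₂ (there (here refl))) = inj₂ (here s≡)
    classify e s≡ (inj₂ (there (here refl))) (inj₁ (there (here refl))) = inj₂ (here (trans s≡ (⟪⟫-comm r q)))
    classify e s≡ (inj₂ (there (here refl))) (inj₂ (there (here refl))) = contradiction refl q≢r

  -- Every edge takes one end from each of two disjoint pairs.
  hits-matching-≤4 : ∀ {p q r s} → Disjoint₂ (p , q) (r , s) → Hits p q → Hits r s → Few 4 Edge
  hits-matching-≤4 {p} {q} {r} {s} (p≢r , p≢s , q≢r , q≢s) hits hits′ = few-list
    (⟪ p ∷ r ∷ [] ⟫ ∷ ⟪ p ∷ s ∷ [] ⟫ ∷ ⟪ q ∷ r ∷ [] ⟫ ∷ ⟪ q ∷ s ∷ [] ⟫ ∷ [])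
    λ (x , y , e , t≡) → classify t≡ (hits e) (hits′ e)
    where
    Listed : Subset n → Set
    Listed t = t ∈ ⟪ p ∷ r ∷ [] ⟫ ∷ ⟪ p ∷ s ∷ [] ⟫ ∷ ⟪ q ∷ r ∷ [] ⟫ ∷ ⟪ q ∷ s ∷ [] ⟫ ∷ []

    disjoint : ∀ {x} → x ∈ p ∷ q ∷ [] → x ∈ r ∷ s ∷ [] → ⊥
    disjoint (here refl) (here eq) = p≢r eq
    disjoint (here refl) (there (here eq)) = p≢s eq
    disjoint (there (here refl)) (here eq) = q≢r eq
    disjoint (there (here refl)) (there (here eq)) = q≢s eq

    listed : ∀ {x y t} → t ≡ ⟪ x ∷ y ∷ [] ⟫ → x ∈ p ∷ q ∷ [] → y ∈ r ∷ s ∷ [] → Listed t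
    listed t≡ (here refl) (here refl) = here t≡
    listed t≡ (here refl) (there (here refl)) = there (here t≡)
    listed t≡ (there (here refl)) (here refl) = there (there (here t≡))
    listed t≡ (there (here refl)) (there (here refl)) = there (there (there (here t≡)))

    classify : ∀ {x y t} → t ≡ ⟪ x ∷ y ∷ [] ⟫ → x ∈ p ∷ q ∷ [] ⊎ y ∈ p ∷ q ∷ [] →
               x ∈ r ∷ s ∷ [] ⊎ y ∈ r ∷ s ∷ [] → Listed t
    classify t≡ (inj₁ x∈) (inj₁ x∈′) = ⊥-elim (disjoint x∈ x∈′)
    classify t≡ (inj₁ x∈) (inj₂ y∈) = listed t≡ x∈ y∈
    classify {x} {y} t≡ (inj₂ y∈) (inj₁ x∈) = listed (trans t≡ (⟪⟫-comm x y)) y∈ x∈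
    classify t≡ (inj₂ y∈) (inj₂ y∈′) = ⊥-elim (disjoint y∈ y∈′)

module _ {n} (A B : Light n) where

  private
    module A = Light A
    module B = Light B

  -- Ten edges are possible in either graph, but not in both at once. Two edges in B give two covers
  -- of A and leave it at most four edges, while an edge of A leaves B at most six. A single edge in
  -- B gives 6 + 1.
  cross-≤10 : (∀ {p q} → B.E p q → A.Hits p q) → (∀ {p q} → A.E p q → B.Hits p q) →
              ∃₂ λ j k → j + k ≤ 10 × Few j A.Edge × Few k B.Edge
  cross-≤10 crossA crossB with some? A.E? | some? B.E?
  ... | _ | no none = 10 , 0 , ℕ.≤-refl , A.edge-≤10 , few-∅ λ (x , y , e , _) → none (x , y , e)
  ... | no none | yes _ = 0 , 10 , ℕ.≤-refl , few-∅ (λ (x , y , e , _) → none (x , y , e)) , B.edge-≤10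
  -- A second edge of B has an end `r` off `p q`; whether `s` lies on `p q` decides between the path
  -- and the matching estimate.
  ... | yes (u , v , uv) | yes (p , q , pq) with some? (λ r s → B.E? r s ×-dec ¬? (r ≟ p) ×-dec ¬? (r ≟ q))
  ... | no none = 6 , 1 , ℕ.m≤m+n 7 3 , A.hits-≤6 (crossA pq) ,
    few-list (⟪ p ∷ q ∷ [] ⟫ ∷ []) λ (x , y , e , s≡) → only e s≡
    where
    end : ∀ {x y} → B.E x y → x ≡ p ⊎ x ≡ q
    end {x} {y} e with x ≟ p | x ≟ q
    ... | yes x≡p | _ = inj₁ x≡p
    ... | no _ | yes x≡q = inj₂ x≡q
    ... | no x≢p | no x≢q = contradiction (x , y , e , x≢p , x≢q) none
    only : ∀ {x y s} → B.E x y → s ≡ ⟪ x ∷ y ∷ [] ⟫ → s ∈ ⟪ p ∷ q ∷ [] ⟫ ∷ []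
    only e s≡ with end e | end (B.E-sym e)
    ... | inj₁ refl | inj₁ refl = contradiction refl (B.E-≢ e)
    ... | inj₁ refl | inj₂ refl = here s≡
    ... | inj₂ refl | inj₁ refl = here (trans s≡ (⟪⟫-comm q p))
    ... | inj₂ refl | inj₂ refl = contradiction refl (B.E-≢ e)
  ... | yes (r , s , rs , r≢p , r≢q) = 4 , 6 , ℕ.≤-refl , four , B.hits-≤6 (crossB uv)
    where
    four : Few 4 A.Edge
    four with s ≟ p | s ≟ q
    ... | yes refl | _ = A.hits-path-≤4 (≢-sym r≢q) (crossA pq) (crossA (B.E-sym rs))
    ... | no _ | yes refl = A.hits-path-≤4 (≢-sym r≢p) (crossA (B.E-sym pq)) (crossA (B.E-sym rs))
    ... | no s≢p | no s≢q =
      A.hits-matching-≤4 (≢-sym r≢p , ≢-sym s≢p , ≢-sym r≢q , ≢-sym s≢q) (crossA pq) (crossA rs)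

module NoSolidPair {n} (G : Graph n) (free : G -free B 4 1)
  (big : ∀ {p x} → Cliques.Clique G p → x ∈ˢ p → ¬ Few 10 (Solidity.Through G free x))
  (no-solid : ∀ {u v x y} → FreeCliques.K₄ G free u v x y → ¬ Solidity.Solid G free u v) where

  open Solidity G free
  open MinDegree G free big

  -- A fourth petal would make the triple heavy and produce a solid pair.
  few-petals : ∀ u v x → Few 3 (K₄ u v x)
  few-petals u v x with few-or-many (K₄? u v x) 3
  ... | inj₁ few = few
  ... | inj₂ heavy@(y ∷ _ , _ , _ , petals) = ⊥-elim (
    Sum.[ no-solid k , Sum.[ no-solid (swap₂₃ k) , no-solid (swap₂₃ (swap₁₂ k)) ] ] (heavy-solid heavy))
    where
    k = petals (here refl)

  Off : (a b c d : Fin n) → Subset n → Set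
  Off a b c d p = (Clique p × a ∈ˢ p × b ∈ˢ p) × c ∉ˢ p × d ∉ˢ p

  off : ∀ {a b c d} → K₄ a b c d → Light n
  off {a} {b} {c} {d} k = record
    { E = λ x y → K₄ a b x y × Out x × Out y
    ; E? = λ x y → K₄? a b x y ×-dec Out? x ×-dec Out? y
    ; E-sym = λ (k , x , y) → swap₃₄ k , y , x
    ; E-≢ = λ { ((_ ∷ _ ∷ (xy ∷ []) ∷ _) , _) → ~⇒≢ xy }
    ; degree = λ x → few-mono ℕ.≤-refl proj₁ (few-petals a b x)
    ; thin = λ M len disjoint edges → no-solid k (matching-solid ((c , d) ∷ M) (cong suc len)
        (All.tabulate (λ e∈ → let _ , (x≢c , x≢d) , (y≢c , y≢d) = edges e∈ in
          ≢-sym x≢c , ≢-sym y≢c , ≢-sym x≢d , ≢-sym y≢d) ∷ disjoint)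
        λ { (here refl) → k ; (there e∈) → proj₁ (edges e∈) })
    }
    where
    Out : Fin n → Set
    Out x = x ≢ c × x ≢ d
    Out? : ∀ x → Dec (Out x)
    Out? x = ¬? (x ≟ c) ×-dec ¬? (x ≟ d)

  off-edge : ∀ {a b c d} (k : K₄ a b c d) {p} → Off a b c d p →
             ∃ λ s → Light.Edge (off k) s × p ≡ ⁅ a ⁆ ∪ (⁅ b ⁆ ∪ s)
  off-edge ((ab ∷ _) ∷ _) ((cl , a∈ , b∈) , c∉ , d∉) with through₂ cl a∈ b∈ (~⇒≢ ab)
  ... | x , y , k , refl = _ , (x , y , (k ,
    ((λ { refl → c∉ (in₃ k) }) , λ { refl → d∉ (in₃ k) }) ,
    ((λ { refl → c∉ (in₄ k) }) , λ { refl → d∉ (in₄ k) })) , refl) , refl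

  -- The two copies share `a` and therefore a second vertex, which is neither `b`, absent from the
  -- second, nor `c`, absent from the first.
  cross-hit : ∀ {a b c x y p q} → a ≢ b → b ≢ c → K₄ a b x y → K₄ a c p q →
              x ≢ c → y ≢ c → p ≢ b → q ≢ b → x ∈ p ∷ q ∷ [] ⊎ y ∈ p ∷ q ∷ []
  cross-hit {a} {b} {c} {x} {y} {p} {q} a≢b b≢c k@((_ ∷ ax ∷ ay ∷ []) ∷ _) k′ x≢c y≢c p≢b q≢b =
    Sum.map (narrow ax x≢c) (narrow ay y≢c)
      (share (K₄-clique k′) k (in₁ k′) (avoids k′ (≢-sym a≢b) b≢c (≢-sym p≢b) (≢-sym q≢b)))
    where
    narrow : ∀ {z} → a ~ z → z ≢ c → z ∈ˢ ⟪ a ⨾ c ⨾ p ⨾ q ⟫ → z ∈ p ∷ q ∷ []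
    narrow az z≢c z∈ with split k′ z∈
    ... | inj₁ refl = contradiction refl (~⇒≢ az)
    ... | inj₂ (inj₁ refl) = contradiction refl z≢c
    ... | inj₂ (inj₂ (inj₁ refl)) = here refl
    ... | inj₂ (inj₂ (inj₂ refl)) = there (here refl)

  -- Treating two edges with a common vertex together costs ten in place of twenty. The saving is
  -- essential: for n = 45 a peeled copy may meet at most 40 copies, and six separate pairs would
  -- already account for 60.
  off-pair-≤10 : ∀ {a b c d} → K₄ a b c d → Few 10 (λ p → Off a b c d p ⊎ Off a c b d p)
  off-pair-≤10 {a} {b} {c} k@((ab ∷ ac ∷ _) ∷ (bc ∷ _) ∷ _) =
    let j , l , ≤10 , fewA , fewB = cross-≤10 (off k) (off (swap₂₃ k))
          (λ (k′ , (p≢b , _) , q≢b , _) (k , (x≢c , _) , y≢c , _) →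
            cross-hit (~⇒≢ ab) (~⇒≢ bc) k k′ x≢c y≢c p≢b q≢b)
          (λ (k , (x≢c , _) , y≢c , _) (k′ , (p≢b , _) , q≢b , _) →
            cross-hit (~⇒≢ ac) (≢-sym (~⇒≢ bc)) k′ k p≢b q≢b x≢c y≢c)
    in few-mono ≤10 id (few-∪ (few-map (λ s → ⁅ a ⁆ ∪ (⁅ b ⁆ ∪ s)) (off-edge k) fewA)
                             (few-map (λ s → ⁅ a ⁆ ∪ (⁅ c ⁆ ∪ s)) (off-edge (swap₂₃ k)) fewB) id)

  Three : (a b c d : Fin n) → Subset n → Set
  Three a b c d p = (Clique p × a ∈ˢ p × b ∈ˢ p × c ∈ˢ p) × d ∉ˢ p

  three-≤2 : ∀ {a b c d} → K₄ a b c d → Few 2 (Three a b c d)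
  three-≤2 {a} {b} {c} {d} k@((ab ∷ ac ∷ _) ∷ (bc ∷ _) ∷ _) =
    few-triple (~⇒≢ ab) (~⇒≢ ac) (~⇒≢ bc) (few-remove (K₄? a b c) (few-petals a b c) k) proj₁
      λ k′ (_ , d∉) → k′ , λ { refl → d∉ (in₄ k′) }

  -- 1 + 4·2 + 3·10: the clique itself, the cliques sharing exactly three vertices with it,
  -- and those sharing exactly two, the six pairs being grouped as (ab, ac), (bc, bd), (da, dc).
  meets-≤39 : ∀ {a b c d} → K₄ a b c d → Few 39 (Meets (a ∷ b ∷ c ∷ d ∷ []))
  meets-≤39 {a} {b} {c} {d} k@((ab ∷ ac ∷ ad ∷ []) ∷ (bc ∷ bd ∷ []) ∷ (cd ∷ []) ∷ _) =
    few-∪ {P = λ p → p ≡ ⟪ a ⨾ b ⨾ c ⨾ d ⟫} (few-list (⟪ a ⨾ b ⨾ c ⨾ d ⟫ ∷ []) here)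
      (few-∪ (few-∪ (few-∪ (three-≤2 k) (three-≤2 (swap₃₄ k)) id)
                    (few-∪ (three-≤2 (swap₃₄ (swap₂₃ k))) (three-≤2 bcda) id) id)
             (few-∪ (off-pair-≤10 k) (few-∪ (off-pair-≤10 bcda) (off-pair-≤10 dacb) id) id) id)
      λ (cl , x , x∈ , x∈p) → classify cl x∈ x∈p
    where
    bcda : K₄ b c d a
    bcda = swap₃₄ (swap₂₃ (swap₁₂ k))

    dacb : K₄ d a c b
    dacb = swap₃₄ (swap₁₂ (swap₂₃ (swap₃₄ k)))

    Case : Subset n → Set
    Case p = p ≡ ⟪ a ⨾ b ⨾ c ⨾ d ⟫ ⊎
      ((Three a b c d p ⊎ Three a b d c p) ⊎ (Three a c d b p ⊎ Three b c d a p)) ⊎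
      ((Off a b c d p ⊎ Off a c b d p) ⊎ (Off b c d a p ⊎ Off b d c a p) ⊎ (Off d a c b p ⊎ Off d c a b p))

    alone : ∀ {u v x y p} → K₄ u v x y → Clique p → u ∈ˢ p → v ∉ˢ p → x ∉ˢ p → y ∉ˢ p → ⊥
    alone k cl u∈ v∉ x∉ y∉ = Sum.[ x∉ , y∉ ] (share cl k u∈ v∉)

    none : ∀ {x p} → x ∈ a ∷ b ∷ c ∷ d ∷ [] → x ∈ˢ p → a ∉ˢ p → b ∉ˢ p → c ∉ˢ p → d ∉ˢ p → ⊥
    none (here refl) x∈p a∉ _ _ _ = a∉ x∈p
    none (there (here refl)) x∈p _ b∉ _ _ = b∉ x∈p
    none (there (there (here refl))) x∈p _ _ c∉ _ = c∉ x∈p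
    none (there (there (there (here refl)))) x∈p _ _ _ d∉ = d∉ x∈p

    classify : ∀ {p x} → Clique p → x ∈ a ∷ b ∷ c ∷ d ∷ [] → x ∈ˢ p → Case p
    classify {p} cl x∈ x∈p with a Sub.∈? p | b Sub.∈? p | c Sub.∈? p | d Sub.∈? p
    ... | yes a∈ | yes b∈ | yes c∈ | yes d∈ = inj₁ (clique≡ k cl a∈ b∈ c∈ d∈)
    ... | yes a∈ | yes b∈ | yes c∈ | no d∉ = inj₂ (inj₁ (inj₁ (inj₁ ((cl , a∈ , b∈ , c∈) , d∉))))
    ... | yes a∈ | yes b∈ | no c∉ | yes d∈ = inj₂ (inj₁ (inj₁ (inj₂ ((cl , a∈ , b∈ , d∈) , c∉))))
    ... | yes a∈ | no b∉ | yes c∈ | yes d∈ = inj₂ (inj₁ (inj₂ (inj₁ ((cl , a∈ , c∈ , d∈) , b∉))))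
    ... | no a∉ | yes b∈ | yes c∈ | yes d∈ = inj₂ (inj₁ (inj₂ (inj₂ ((cl , b∈ , c∈ , d∈) , a∉))))
    ... | yes a∈ | yes b∈ | no c∉ | no d∉ = inj₂ (inj₂ (inj₁ (inj₁ ((cl , a∈ , b∈) , c∉ , d∉))))
    ... | yes a∈ | no b∉ | yes c∈ | no d∉ = inj₂ (inj₂ (inj₁ (inj₂ ((cl , a∈ , c∈) , b∉ , d∉))))
    ... | no a∉ | yes b∈ | yes c∈ | no d∉ = inj₂ (inj₂ (inj₂ (inj₁ (inj₁ ((cl , b∈ , c∈) , d∉ , a∉)))))
    ... | no a∉ | yes b∈ | no c∉ | yes d∈ = inj₂ (inj₂ (inj₂ (inj₁ (inj₂ ((cl , b∈ , d∈) , c∉ , a∉)))))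
    ... | yes a∈ | no b∉ | no c∉ | yes d∈ = inj₂ (inj₂ (inj₂ (inj₂ (inj₁ ((cl , d∈ , a∈) , c∉ , b∉)))))
    ... | no a∉ | no b∉ | yes c∈ | yes d∈ = inj₂ (inj₂ (inj₂ (inj₂ (inj₂ ((cl , d∈ , c∈) , a∉ , b∉)))))
    ... | yes a∈ | no b∉ | no c∉ | no d∉ = ⊥-elim (alone k cl a∈ b∉ c∉ d∉)
    ... | no a∉ | yes b∈ | no c∉ | no d∉ = ⊥-elim (alone bcda cl b∈ c∉ d∉ a∉)
    ... | no a∉ | no b∉ | yes c∈ | no d∉ = ⊥-elim (alone (swap₁₂ (swap₂₃ k)) cl c∈ a∉ b∉ d∉)
    ... | no a∉ | no b∉ | no c∉ | yes d∈ = ⊥-elim (alone dacb cl d∈ a∉ c∉ b∉)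
    ... | no a∉ | no b∉ | no c∉ | no d∉ = ⊥-elim (none x∈ x∈p a∉ b∉ c∉ d∉)

-- Links of solid pairs

module Links {n} (G : Graph n) (free : G -free B 4 1)
  (big : ∀ {p x} → Cliques.Clique G p → x ∈ˢ p → ¬ Few 10 (Solidity.Through G free x)) where

  open Solidity G free public
  open MinDegree G free big

  module Link {u v : Fin n} (u≢v : u ≢ v) (solid : Solid u v) where

    L : Fin n → Fin n → Set
    L = K₄ u v

    L? : ∀ x y → Dec (L x y)
    L? = K₄? u v

    L-≢ : ∀ {x y} → L x y → x ≢ y
    L-≢ (_ ∷ _ ∷ (xy ∷ []) ∷ _) = ~⇒≢ xy

    -- By solidity a copy through `x` and `u` contains `v`, so it is determined by its fourth
    -- vertex, a link neighbour of `x`.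
    with-u : ∀ {x} {P : Fin n → Set} {k} {Q : Subset n → Set} → ∀ {y} → L x y → Few k P →
             (∀ {p} → Q p → Clique p × x ∈ˢ p × u ∈ˢ p) → (∀ {z} → L x z → P z) → Few k Q
    with-u ((uv ∷ ux ∷ _) ∷ (vx ∷ _) ∷ _) few contains link =
      few-triple (~⇒≢ uv) (~⇒≢ ux) (~⇒≢ vx) few
        (λ q → let cl , x∈ , u∈ = contains q in cl , u∈ , proj₁ solid cl u∈ , x∈) λ k _ → link k

    triangle-free : ∀ {x y z} → L x y → L y z → ¬ L x z
    triangle-free ((uv ∷ ux ∷ uy ∷ []) ∷ (vx ∷ vy ∷ []) ∷ (xy ∷ []) ∷ _)
      ((_ ∷ _ ∷ uz ∷ []) ∷ (_ ∷ vz ∷ []) ∷ (yz ∷ []) ∷ _) (_ ∷ _ ∷ (xz ∷ []) ∷ _) =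
      avoids k (≢-sym (~⇒≢ uv)) (~⇒≢ vx) (~⇒≢ vy) (~⇒≢ vz) (proj₁ solid (K₄-clique k) (in₁ k))
      where
      k : K₄ u _ _ _
      k = (ux ∷ uy ∷ uz ∷ []) ∷ (xy ∷ xz ∷ []) ∷ (yz ∷ []) ∷ [] ∷ []

    -- Missing `u`, the copy also misses `v`, so `y` is the only vertex it can share with `u v x y`
    -- besides `x`.
    neighbour∈ : ∀ {p x y} → Clique p → x ∈ˢ p → u ∉ˢ p → L x y → y ∈ˢ p
    neighbour∈ cl x∈ u∉ k with share cl (swap₁₂ (swap₂₃ k)) x∈ u∉
    ... | inj₁ v∈ = contradiction (proj₂ solid cl v∈) u∉
    ... | inj₂ y∈ = y∈

    Branching : Fin n → Set
    Branching x = ∃₂ λ y z → L x y × L x z × y ≢ z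

    Branching? : ∀ x → Dec (Branching x)
    Branching? x = some? λ y z → L? x y ×-dec L? x z ×-dec ¬? (y ≟ z)

    -- A copy through `x` without `u` contains all link neighbours of `x`, so these are at most
    -- three, and so are the copies through `x` and `u`. The copies through `x` without `u` all
    -- contain `y` and `z`. If `x y z` is not heavy there are at most 3 + 3 copies through `x`,
    -- against `big`. If it is heavy, one of its pairs is solid, yet `u v x z` separates `x` from
    -- `y`, and `u v x y` separates `z` from `x` and from `y`.
    branching-u∈ : ∀ {x p} → Branching x → Clique p → x ∈ˢ p → u ∈ˢ p
    branching-u∈ {x} {p} (y , z , xy , xz , y≢z) cl x∈ with u Sub.∈? p
    ... | yes u∈ = u∈
    ... | no u∉ with few-or-many (K₄? x y z) 3
    ... | inj₁ few = ⊥-elim (big cl x∈ (few-mono (ℕ.m≤m+n 6 4) id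
        (few-∪ (with-u xy few-neighbours id id) (few-triple x≢y x≢z y≢z few proj₁ λ k _ → k) classify)))
      where
      x≢y = L-≢ xy
      x≢z = L-≢ xz

      few-neighbours : Few 3 (L x)
      few-neighbours with through₁ cl x∈
      ... | b , c , d , k , refl = b ∷ c ∷ d ∷ [] , ℕ.≤-refl , λ xw →
        case ∈⟪⟫⁻ (x ∷ b ∷ c ∷ d ∷ []) (neighbour∈ cl x∈ u∉ xw) of λ
          { (here w≡x) → contradiction (sym w≡x) (L-≢ xw) ; (there w∈) → w∈ }

      WithU WithoutU : Subset n → Set
      WithU q = Clique q × x ∈ˢ q × u ∈ˢ q
      WithoutU q = (Clique q × x ∈ˢ q × y ∈ˢ q × z ∈ˢ q) × u ∉ˢ q

      classify : ∀ {q} → Through x q → WithU q ⊎ WithoutU q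
      classify {q} (cl , x∈) with u Sub.∈? q
      ... | yes u∈ = inj₁ (cl , x∈ , u∈)
      ... | no u∉ = inj₂ ((cl , x∈ , neighbour∈ cl x∈ u∉ xy , neighbour∈ cl x∈ u∉ xz) , u∉)
    ... | inj₂ heavy = ⊥-elim (Sum.[ no-xy xy xz y≢z , Sum.[ no-xy xz xy (≢-sym y≢z) , no-yz ] ] (heavy-solid heavy))
      where
      no-xy : ∀ {y z} → L x y → L x z → y ≢ z → ¬ Solid x y
      no-xy xy@((_ ∷ _ ∷ uy ∷ []) ∷ (_ ∷ vy ∷ []) ∷ _) xz y≢z (x⇒y , _) =
        avoids xz (≢-sym (~⇒≢ uy)) (≢-sym (~⇒≢ vy)) (≢-sym (L-≢ xy)) y≢z (x⇒y (K₄-clique xz) (in₃ xz))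
      no-yz : ¬ Solid y z
      no-yz (y⇒z , _) = case xz of λ
        { ((_ ∷ _ ∷ uz ∷ []) ∷ (_ ∷ vz ∷ []) ∷ _) →
          avoids xy (≢-sym (~⇒≢ uz)) (≢-sym (~⇒≢ vz)) (≢-sym (L-≢ xz)) (≢-sym y≢z) (y⇒z (K₄-clique xy) (in₄ xy)) }

    Isolated : (x y : Fin n) → Set
    Isolated x y = L x y × (∀ {z} → L x z → z ≡ y)

    isolated : ∀ {x y} → ¬ Branching x → L x y → Isolated x y
    isolated {x} {y} ¬branch xy = xy , λ {z} xz → case z ≟ y of λ
      { (yes z≡y) → z≡y ; (no z≢y) → contradiction (z , y , xz , xy , z≢y) ¬branch }

    isolated-¬branching : ∀ {x y} → Isolated x y → ¬ Branching x
    isolated-¬branching (_ , only) (_ , _ , xz , xw , z≢w) = z≢w (trans (only xz) (sym (only xw)))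

    -- Without `u` in the copy this is `neighbour∈`; with `u` also `v` is present, and the fourth
    -- vertex is a link neighbour of `x`.
    isolated-∈ : ∀ {x y p} → Isolated x y → Clique p → x ∈ˢ p → y ∈ˢ p
    isolated-∈ {x} {y} {p} (xy@((uv ∷ ux ∷ _) ∷ (vx ∷ _) ∷ _) , only) cl x∈ with u Sub.∈? p
    ... | no u∉ = neighbour∈ cl x∈ u∉ xy
    ... | yes u∈ with through₃ cl u∈ (proj₁ solid cl u∈) x∈ (~⇒≢ uv) (~⇒≢ ux) (~⇒≢ vx)
    ... | z , xz , refl = subst (_∈ˢ _) (only xz) (in₄ xz)

    -- If y branched, every clique through x would contain y, hence u, hence be u v x y.
    isolated-sym : ∀ {x y} → Isolated x y → Isolated y x
    isolated-sym {x} {y} iso@(xy , only) with Branching? y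
    ... | no ¬branch = isolated ¬branch (swap₃₄ xy)
    ... | yes branch = ⊥-elim (big (K₄-clique xy) (in₃ xy) (few-mono (ℕ.m≤m+n 1 9) id
      (with-u xy (few-list (y ∷ []) (here ∘ only))
        (λ (cl , x∈) → cl , x∈ , branching-u∈ branch cl (isolated-∈ iso cl x∈)) id)))

    -- Supplies the second solid pair that `matching-outcome` plays against `u v`.
    isolated-solid : ∀ {x y} → Isolated x y → Solid x y
    isolated-solid iso = isolated-∈ iso , isolated-∈ (isolated-sym iso)

-- Counting the edges of a link

sum-≤ : ∀ {A : Set} (f : A → ℕ) {b} xs → (∀ {x} → x ∈ xs → f x ≤ b) → sum (map f xs) ≤ length xs * b
sum-≤ f [] _ = z≤n
sum-≤ f (x ∷ xs) f≤ = ℕ.+-mono-≤ (f≤ (here refl)) (sum-≤ f xs (f≤ ∘ there))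

sum-≥⇒≡ : ∀ {A : Set} (f : A → ℕ) {b} xs → (∀ {x} → x ∈ xs → f x ≤ b) → length xs * b ≤ sum (map f xs) →
          ∀ {x} → x ∈ xs → b ≤ f x
sum-≥⇒≡ f {b} (x ∷ xs) f≤ ≤sum x∈ with b ℕ.≤? f x
... | no b≰fx = contradiction ≤sum (ℕ.<⇒≱ (ℕ.+-mono-<-≤ (ℕ.≰⇒> b≰fx) (sum-≤ f xs (f≤ ∘ there))))
sum-≥⇒≡ f {b} (x ∷ xs) f≤ ≤sum (here refl) | yes b≤fx = b≤fx
sum-≥⇒≡ f {b} (x ∷ xs) f≤ ≤sum (there x∈) | yes b≤fx = sum-≥⇒≡ f xs (f≤ ∘ there)
  (ℕ.+-cancelˡ-≤ b _ _ (ℕ.≤-trans ≤sum (ℕ.+-monoˡ-≤ _ (f≤ (here refl))))) x∈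

length-≤n : ∀ {n} {xs : List (Fin n)} → Unique xs → length xs ≤ n
length-≤n {n} uxs = ℕ.≤-trans (length-⊆ uxs (λ _ → ∈-allFin _)) (ℕ.≤-reflexive (List.length-tabulate id))

maximum : ∀ {n} {P : Fin n → Set} (P? : Decidable P) (f : Fin n → ℕ) → ∃ P →
          ∃ λ x → P x × (∀ {y} → P y → f y ≤ f x)
maximum {P = P} P? f (x₀ , p₀) =
  argmax f x₀ (enum P?) , argmax-all f {P = P} p₀ (All.tabulate (∈-enum⁻ P?)) ,
  λ py → All.lookup (f[xs]≤f[argmax] {f = f} x₀ (enum P?)) (∈-enum⁺ P? py)

module LinkCounts {n} (G : Graph n) (free : G -free B 4 1)
  (big : ∀ {p x} → Cliques.Clique G p → x ∈ˢ p → ¬ Few 10 (Solidity.Through G free x)) where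

  open Links G free big public

  module Counting {u v : Fin n} (u≢v : u ≢ v) (solid : Solid u v) where

    open Link u≢v solid public

    clique-edge : ∀ {p} → Through u p → ∃₂ λ x y → L x y × p ≡ ⟪ u ⨾ v ⨾ x ⨾ y ⟫
    clique-edge (cl , u∈) = through₂ cl u∈ (proj₁ solid cl u∈) u≢v

    swap-set : ∀ {p x y} → L x y → p ≡ ⟪ u ⨾ v ⨾ x ⨾ y ⟫ → p ≡ ⟪ u ⨾ v ⨾ y ⨾ x ⟫
    swap-set {x = x} {y} _ eq = trans eq (cong (λ s → ⁅ u ⁆ ∪ (⁅ v ⁆ ∪ s)) (⟪⟫-comm x y))

    partner : Fin n → Fin n
    partner x with Fin.any? (L? x)
    ... | yes (y , _) = y
    -- An arbitrary value for vertices outside the link.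
    ... | no _ = x

    partner≡ : ∀ {x y} → Isolated x y → y ≡ partner x
    partner≡ {x} (xy , only) with Fin.any? (L? x)
    ... | yes (_ , xz) = sym (only xz)
    ... | no none = contradiction (_ , xy) none

    -- If no vertex branches, the link is a matching: the lower ends alone count its edges, so do
    -- the upper ends, and the two sets are disjoint. Their sizes enter `quarter` separately.
    Below Above : Fin n → Set
    Below x = ∃ λ y → L x y × x <ᶠ y
    Above x = ∃ λ y → L x y × y <ᶠ x

    Below? : Decidable Below
    Below? x = Fin.any? λ y → L? x y ×-dec (x <? y)

    Above? : Decidable Above
    Above? x = Fin.any? λ y → L? x y ×-dec (y <? x)

    module _ (¬branching : ∀ x → ¬ Branching x) where

      few-by : {P : Fin n → Set} (P? : Decidable P) → (∀ {x y} → L x y → P x ⊎ P y) → Few (card P?) (Through u)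
      few-by {P} P? oriented = few-map (λ x → ⟪ u ⨾ v ⨾ x ⨾ partner x ⟫) preimage (few-card P?)
        where
        at : ∀ {p x y} → L x y → p ≡ ⟪ u ⨾ v ⨾ x ⨾ y ⟫ → P x → ∃ λ x → P x × p ≡ ⟪ u ⨾ v ⨾ x ⨾ partner x ⟫
        at {x = x} xy p≡ px =
          x , px , trans p≡ (cong (λ y → ⟪ u ⨾ v ⨾ x ⨾ y ⟫) (partner≡ (isolated (¬branching x) xy)))
        preimage : ∀ {p} → Through u p → ∃ λ x → P x × p ≡ ⟪ u ⨾ v ⨾ x ⨾ partner x ⟫
        preimage t with clique-edge t
        ... | x , y , xy , p≡ = Sum.[ at xy p≡ , at (swap₃₄ xy) (swap-set xy p≡) ] (oriented xy)

      few-below : Few (card Below?) (Through u)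
      few-below = few-by Below? λ {x} {y} xy → case Fin.<-cmp x y of λ
        { (tri< x<y _ _) → inj₁ (y , xy , x<y) ; (tri≈ _ x≡y _) → contradiction x≡y (L-≢ xy)
        ; (tri> _ _ y<x) → inj₂ (x , swap₃₄ xy , y<x) }

      few-above : Few (card Above?) (Through u)
      few-above = few-by Above? λ {x} {y} xy → case Fin.<-cmp x y of λ
        { (tri< x<y _ _) → inj₂ (x , swap₃₄ xy , x<y) ; (tri≈ _ x≡y _) → contradiction x≡y (L-≢ xy)
        ; (tri> _ _ y<x) → inj₁ (y , xy , y<x) }

      ends : List (Fin n)
      ends = enum Below? ++ enum Above?

      ∈-ends : ∀ {x} → x ∈ ends → ∃ (L x)
      ∈-ends x∈ with ∈-++⁻ (enum Below?) x∈
      ... | inj₁ x∈ = let y , xy , _ = ∈-enum⁻ Below? x∈ in y , xy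
      ... | inj₂ x∈ = let y , xy , _ = ∈-enum⁻ Above? x∈ in y , xy

      ends-unique : Unique ends
      ends-unique = Unique.++⁺ (enum-unique Below?) (enum-unique Above?) λ (x∈ , x∈′) →
        let y , xy , x<y = ∈-enum⁻ Below? x∈; z , xz , z<x = ∈-enum⁻ Above? x∈′ in
        ℕ.<-asym x<y (subst (_<ᶠ _) (proj₂ (isolated (¬branching _) xy) xz) z<x)

    degree : Fin n → ℕ
    degree x = card (L? x)

    module Branched {top} (top-branching : Branching top)
      (top-max : ∀ {x} → Branching x → degree x ≤ degree top) where

      ¬LN : ∀ {x y} → L top x → L top y → ¬ L x y
      ¬LN tx ty xy = triangle-free tx xy ty

      Other : Fin n → Set
      Other x = Branching x × ¬ L top x

      Other? : Decidable Other
      Other? x = Branching? x ×-dec ¬? (L? top x)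

      End : Fin n → Set
      End x = ∃ (L x) × ¬ Branching x

      End? : Decidable End
      End? x = Fin.any? (L? x) ×-dec ¬? (Branching? x)

      -- `N` is the largest neighbourhood of a branching vertex, independent because the link is
      -- triangle-free. `M` holds the other branching vertices, `top` among them, and `I` the ends
      -- of isolated link edges.
      N M I R : List (Fin n)
      N = enum (L? top)
      M = enum Other?
      I = enum End?
      R = u ∷ v ∷ N ++ M

      -- A neighbour that does not branch would be an end of an isolated edge, and isolation is
      -- symmetric. So the link splits into its branching part and isolated edges.
      branching-spreads : ∀ {x y} → Branching x → L x y → Branching y
      branching-spreads {x} {y} b xy with Branching? y
      ... | yes b′ = b′
      ... | no ¬b′ = contradiction b (isolated-¬branching (isolated-sym (isolated ¬b′ (swap₃₄ xy))))

      ∈N++M : ∀ {x} → x ∈ N ++ M → Branching x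
      ∈N++M x∈ with ∈-++⁻ N x∈
      ... | inj₁ x∈N = branching-spreads top-branching (∈-enum⁻ (L? top) x∈N)
      ... | inj₂ x∈M = proj₁ (∈-enum⁻ Other? x∈M)

      N++M-∋ : ∀ {x} → Branching x → x ∈ N ++ M
      N++M-∋ {x} b with L? top x
      ... | yes tx = ∈-++⁺ˡ (∈-enum⁺ (L? top) tx)
      ... | no ¬tx = ∈-++⁺ʳ N (∈-enum⁺ Other? (b , ¬tx))

      linked-≢ : ∀ {x y} → L x y → u ≢ x × v ≢ x
      linked-≢ ((_ ∷ ux ∷ _) ∷ (vx ∷ _) ∷ _) = ~⇒≢ ux , ~⇒≢ vx

      R-unique : Unique R
      R-unique =
        (u≢v ∷ All.tabulate (λ x∈ → proj₁ (≢-hubs x∈))) ∷ All.tabulate (λ x∈ → proj₂ (≢-hubs x∈)) ∷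
        Unique.++⁺ (enum-unique (L? top)) (enum-unique Other?)
          λ (x∈N , x∈M) → proj₂ (∈-enum⁻ Other? x∈M) (∈-enum⁻ (L? top) x∈N)
        where
        ≢-hubs : ∀ {x} → x ∈ N ++ M → u ≢ x × v ≢ x
        ≢-hubs x∈ = let y , _ , xy , _ = ∈N++M x∈ in linked-≢ xy

      R++I-unique : Unique (R ++ I)
      R++I-unique = Unique.++⁺ R-unique (enum-unique End?) λ (x∈R , x∈I) → apart x∈R (∈-enum⁻ End? x∈I)
        where
        apart : ∀ {x} → x ∈ R → ¬ End x
        apart (here refl) ((_ , xy) , _) = proj₁ (linked-≢ xy) refl
        apart (there (here refl)) ((_ , xy) , _) = proj₂ (linked-≢ xy) refl
        apart (there (there x∈)) (_ , ¬b) = ¬b (∈N++M x∈)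

      R-through : ∀ {p} → Meets R p → Through u p
      R-through (cl , _ , here refl , u∈) = cl , u∈
      R-through (cl , _ , there (here refl) , v∈) = cl , proj₂ solid cl v∈
      R-through (cl , _ , there (there x∈) , x∈p) = cl , branching-u∈ (∈N++M x∈) cl x∈p

      -- Each edge is charged to an end outside N = N(top); between two such ends the smaller one pays.
      Charged : Fin n → Fin n → Set
      Charged x y = L x y × (L top y ⊎ x <ᶠ y)

      Charged? : ∀ x y → Dec (Charged x y)
      Charged? x y = L? x y ×-dec (L? top y ⊎-dec (x <? y))

      charge : Fin n → ℕ
      charge x = card (Charged? x)

      charge-≤ : ∀ {x} → x ∈ M → charge x ≤ length N
      charge-≤ {x} x∈M = ℕ.≤-trans
        (length-⊆ (enum-unique (Charged? x)) (∈-enum⁺ (L? x) ∘ proj₁ ∘ ∈-enum⁻ (Charged? x)))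
        (top-max (proj₁ (∈-enum⁻ Other? x∈M)))

      -- Edges of the branching part are paid for in `M`. Isolated edges are counted once from each
      -- end, a factor of two that `gain-wide` can afford.
      few-through : Few (sum (map charge M) + length I) (Through u)
      few-through = few-∪
        (few-⋃ {is = M} charge {P = Payer}
          (λ {x} _ → few-map (λ y → ⟪ u ⨾ v ⨾ x ⨾ y ⟫) id (few-card (Charged? x))) id)
        (few-map {P = End} (λ x → ⟪ u ⨾ v ⨾ x ⨾ partner x ⟫) id (few-card End?))
        classify
        where
        Payer : Fin n → Subset n → Set
        Payer x p = ∃ λ y → Charged x y × p ≡ ⟪ u ⨾ v ⨾ x ⨾ y ⟫

        Paid Ended : Subset n → Set
        Paid p = ∃ λ x → x ∈ M × Payer x p
        Ended p = ∃ λ x → End x × p ≡ ⟪ u ⨾ v ⨾ x ⨾ partner x ⟫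

        pay : ∀ {x y p} → Branching x → ¬ L top x → L x y → L top y ⊎ x <ᶠ y → p ≡ ⟪ u ⨾ v ⨾ x ⨾ y ⟫ → Paid p
        pay {x} {y} b ¬tx xy c p≡ = x , ∈-enum⁺ Other? (b , ¬tx) , y , (xy , c) , p≡

        classify : ∀ {p} → Through u p → Paid p ⊎ Ended p
        classify t with clique-edge t
        ... | x , y , xy , p≡ with Branching? x
        ... | no ¬b = inj₂ (x , ((y , xy) , ¬b) ,
          trans p≡ (cong (λ y → ⟪ u ⨾ v ⨾ x ⨾ y ⟫) (partner≡ (isolated ¬b xy))))
        ... | yes b with L? top x | L? top y
        ... | yes tx | yes ty = contradiction xy (¬LN tx ty)
        ... | no ¬tx | yes ty = inj₁ (pay b ¬tx xy (inj₁ ty) p≡)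
        ... | yes tx | no ¬ty = inj₁ (pay (branching-spreads b xy) ¬ty (swap₃₄ xy) (inj₁ tx) (swap-set xy p≡))
        ... | no ¬tx | no ¬ty with Fin.<-cmp x y
        ... | tri< x<y _ _ = inj₁ (pay b ¬tx xy (inj₂ x<y) p≡)
        ... | tri≈ _ x≡y _ = contradiction x≡y (L-≢ xy)
        ... | tri> _ _ y<x = inj₁ (pay (branching-spreads b xy) ¬ty (swap₃₄ xy) (inj₂ y<x) (swap-set xy p≡))

      -- All copies through `top` contain `u`, so they are counted by the link neighbours of `top`,
      -- and there are more than ten of them.
      11≤N : 11 ≤ length N
      11≤N = ℕ.≰⇒> λ ≤10 → case top-branching of λ (y , _ , ty , _) →
        big (K₄-clique ty) (in₃ ty) (few-mono ≤10 id (with-u ty (few-card (L? top))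
          (λ (cl , t∈) → cl , t∈ , branching-u∈ top-branching cl t∈) id))

unique-↭ : ∀ {A : Set} {xs ys : List A} → Unique xs → Unique ys → xs ⊆ ys → ys ⊆ xs → ys ↭ xs
unique-↭ {xs = xs} {ys} uxs uys sub sup with extract uxs sub
... | [] , p = ↭-trans p (Perm.++-identityʳ xs)
... | z ∷ zs , p = ⊥-elim (ℕ.m+1+n≰m (length xs) (begin
  length xs + suc (length zs)  ≡⟨ List.length-++ xs ⟨
  length (xs ++ z ∷ zs)        ≡⟨ Perm.↭-length p ⟨
  length ys                    ≤⟨ length-⊆ uys sup ⟩
  length xs                    ∎))
  where open ℕ.≤-Reasoning

-- Joins of an edge with a complete bipartite graph

unique-++⁻ : ∀ {A : Set} xs {ys : List A} → Unique (xs ++ ys) → Unique xs × Unique ys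
unique-++⁻ [] uys = [] , uys
unique-++⁻ (x ∷ xs) (x∉ ∷ u) = let uxs , uys = unique-++⁻ xs u in AllP.++⁻ˡ xs x∉ ∷ uxs , uys

length-cartesianProduct : ∀ {A B : Set} (xs : List A) (ys : List B) →
                          length (cartesianProduct xs ys) ≡ length xs * length ys
length-cartesianProduct [] ys = refl
length-cartesianProduct (x ∷ xs) ys =
  trans (List.length-++ (map (x ,_) ys)) (cong₂ _+_ (List.length-map (x ,_) ys) (length-cartesianProduct xs ys))

map-unique-∈ : ∀ {A B : Set} (f : A → B) {xs} → (∀ {x y} → x ∈ xs → y ∈ xs → f x ≡ f y → x ≡ y) →
               Unique xs → Unique (map f xs)
map-unique-∈ f inj [] = []
map-unique-∈ f {x ∷ xs} inj (x∉ ∷ uxs) =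
  All.tabulate (λ fy∈ fx≡ → let y , y∈ , ≡fy = ∈-map⁻ f fy∈ in
    All.lookup x∉ y∈ (inj (here refl) (there y∈) (trans fx≡ ≡fy))) ∷
  map-unique-∈ f (λ x∈ y∈ → inj (there x∈) (there y∈)) uxs

module _ {A : Set} where

  as-tabulate : ∀ {n} (xs : List A) → length xs ≡ n → ∃ λ (f : Fin n → A) → tabulate f ≡ xs
  as-tabulate xs refl = lookup xs , List.tabulate-lookup xs

  tabulate-≗ : ∀ {n} {f g : Fin n → A} → tabulate f ≡ tabulate g → ∀ i → f i ≡ g i
  tabulate-≗ eq zero = List.∷-injectiveˡ eq
  tabulate-≗ eq (suc i) = tabulate-≗ (List.∷-injectiveʳ eq) i

  tabulate-injective : ∀ {n} {f : Fin n → A} → Unique (tabulate f) → ∀ i j → f i ≡ f j → i ≡ j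
  tabulate-injective _ zero zero _ = refl
  tabulate-injective (f0∉ ∷ _) zero (suc j) eq = contradiction eq (All.lookup f0∉ (∈-tabulate⁺ j))
  tabulate-injective (f0∉ ∷ _) (suc i) zero eq = contradiction (sym eq) (All.lookup f0∉ (∈-tabulate⁺ i))
  tabulate-injective (_ ∷ u) (suc i) (suc j) eq = cong suc (tabulate-injective u i j eq)

-- A permutation between the lists of colours lifts to a permutation of the vertices, so two joins
-- can be matched by comparing the sizes of their colour classes.
recolouring : ∀ {n} {C : Set} (c d : Fin n → C) → map d (allFin n) ↭ map c (allFin n) →
              ∃ λ (f : Fin n → Fin n) → Bijective _≡_ _≡_ f × (∀ i → d (f i) ≡ c i)
recolouring {n} c d p =
  let ys , cs≡ , p′ = Perm.↭-map-inv d p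
      f , f≡ = as-tabulate ys (trans (sym (Perm.↭-length p′)) (List.length-tabulate id))
  in f , bijective f (subst (allFin n ↭_) (sym f≡) p′) , tabulate-≗ (begin
    tabulate (d ∘ f)    ≡⟨ List.map-tabulate f d ⟨
    map d (tabulate f)  ≡⟨ cong (map d) f≡ ⟩
    map d ys            ≡⟨ cs≡ ⟨
    map c (allFin n)    ≡⟨ List.map-tabulate id c ⟩
    tabulate c          ∎)
  where
  open ≡-Reasoning
  bijective : (f : Fin n → Fin n) → allFin n ↭ tabulate f → Bijective _≡_ _≡_ f
  bijective f p = (λ {i} {j} → tabulate-injective (unique-↭⁺ p (Unique.allFin⁺ n)) i j) , λ y →
    let x , y≡ = ∈-tabulate⁻ (Perm.∈-resp-↭ p (∈-allFin y)) in x , λ { refl → sym y≡ }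

map-const : ∀ {A B : Set} (f : A → B) {b} xs → (∀ {x} → x ∈ xs → f x ≡ b) → map f xs ≡ replicate (length xs) b
map-const f [] _ = refl
map-const f (x ∷ xs) f≡ = cong₂ _∷_ (f≡ (here refl)) (map-const f xs (f≡ ∘ there))

record Join {n} (G : Graph n) (N M : List (Fin n)) : Set where
  field
    {u v}    : Fin n
    covers   : ∀ x → x ∈ u ∷ v ∷ N ++ M
    unique   : Unique (u ∷ v ∷ N ++ M)
    u-all    : ∀ {x} → u ≢ x → adj G u x ≡ true
    v-all    : ∀ {x} → v ≢ x → adj G v x ≡ true
    across   : ∀ {x y} → x ∈ N → y ∈ M → adj G x y ≡ true
    inside-N : ∀ {x y} → x ∈ N → y ∈ N → adj G x y ≡ false
    inside-M : ∀ {x y} → x ∈ M → y ∈ M → adj G x y ≡ false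

  data Place (x : Fin n) : Set where
    is-u : x ≡ u → Place x
    is-v : x ≡ v → Place x
    in-N : x ∈ N → Place x
    in-M : x ∈ M → Place x

  place : ∀ x → Place x
  place x with covers x
  ... | here x≡u = is-u x≡u
  ... | there (here x≡v) = is-v x≡v
  ... | there (there x∈) = Sum.[ in-N , in-M ] (∈-++⁻ N x∈)

  u≢v : u ≢ v
  u≢v = All.head (AllPairs.head unique)

  u∉ : ∀ {x} → x ∈ N ++ M → u ≢ x
  u∉ = All.lookup (All.tail (AllPairs.head unique))

  v∉ : ∀ {x} → x ∈ N ++ M → v ≢ x
  v∉ = All.lookup (AllPairs.head (AllPairs.tail unique))

  disjoint : ∀ {x} → x ∈ N → x ∉ M
  disjoint x∈N x∈M = case trans (sym (across x∈N x∈M)) (adj-irrefl G _) of λ ()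

  size : length N + length M + 2 ≡ n
  size = begin
    length N + length M + 2      ≡⟨ ℕ.+-comm (length N + length M) 2 ⟩
    2 + (length N + length M)    ≡⟨ cong (2 +_) (List.length-++ N) ⟨
    length (u ∷ v ∷ N ++ M)      ≡⟨ Perm.↭-length (unique-↭ (Unique.allFin⁺ n) unique (λ _ → covers _) (λ _ → ∈-allFin _)) ⟩
    length (allFin n)            ≡⟨ List.length-tabulate id ⟩
    n                            ∎
    where open ≡-Reasoning

  unique-N++M : Unique (N ++ M)
  unique-N++M = AllPairs.tail (AllPairs.tail unique)

data Colour : Set where
  hub left right : Colour

joined : Colour → Colour → Bool
joined left left = false
joined right right = false
joined _ _ = true

module _ {n} {G : Graph n} {N M} (J : Join G N M) where

  open Join J

  colour : Fin n → Colour
  colour x with any? (x ≟_) N | any? (x ≟_) M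
  ... | yes _ | _ = left
  ... | no _ | yes _ = right
  ... | no _ | no _ = hub

  colour-hub : ∀ {x} → (∀ {y} → y ∈ N ++ M → x ≢ y) → colour x ≡ hub
  colour-hub {x} x∉ with any? (x ≟_) N | any? (x ≟_) M
  ... | yes x∈N | _ = contradiction refl (x∉ (∈-++⁺ˡ x∈N))
  ... | no _ | yes x∈M = contradiction refl (x∉ (∈-++⁺ʳ N x∈M))
  ... | no _ | no _ = refl

  colour-N : ∀ {x} → x ∈ N → colour x ≡ left
  colour-N {x} x∈N with any? (x ≟_) N
  ... | yes _ = refl
  ... | no x∉N = contradiction x∈N x∉N

  colour-M : ∀ {x} → x ∈ M → colour x ≡ right
  colour-M {x} x∈M with any? (x ≟_) N | any? (x ≟_) M
  ... | yes x∈N | _ = contradiction x∈M (disjoint x∈N)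
  ... | no _ | yes _ = refl
  ... | no _ | no x∉M = contradiction x∈M x∉M

  joined-hubʳ : ∀ c → joined c hub ≡ true
  joined-hubʳ hub = refl
  joined-hubʳ left = refl
  joined-hubʳ right = refl

  -- Since adjacency depends on colours alone, a bijection preserving colours is an isomorphism of
  -- joins.
  adj-colour : ∀ {x y} → x ≢ y → adj G x y ≡ joined (colour x) (colour y)
  adj-colour {x} {y} x≢y with place x | place y
  ... | is-u refl | _ rewrite colour-hub u∉ = u-all x≢y
  ... | is-v refl | _ rewrite colour-hub v∉ = v-all x≢y
  ... | in-N _ | is-u refl rewrite colour-hub u∉ | joined-hubʳ (colour x) = trans (adj-sym G x u) (u-all (≢-sym x≢y))
  ... | in-M _ | is-u refl rewrite colour-hub u∉ | joined-hubʳ (colour x) = trans (adj-sym G x u) (u-all (≢-sym x≢y))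
  ... | in-N _ | is-v refl rewrite colour-hub v∉ | joined-hubʳ (colour x) = trans (adj-sym G x v) (v-all (≢-sym x≢y))
  ... | in-M _ | is-v refl rewrite colour-hub v∉ | joined-hubʳ (colour x) = trans (adj-sym G x v) (v-all (≢-sym x≢y))
  ... | in-N x∈ | in-N y∈ rewrite colour-N x∈ | colour-N y∈ = inside-N x∈ y∈
  ... | in-N x∈ | in-M y∈ rewrite colour-N x∈ | colour-M y∈ = across x∈ y∈
  ... | in-M x∈ | in-N y∈ rewrite colour-M x∈ | colour-N y∈ = trans (adj-sym G x y) (across y∈ x∈)
  ... | in-M x∈ | in-M y∈ rewrite colour-M x∈ | colour-M y∈ = inside-M x∈ y∈

  colours-↭ : map colour (allFin n) ↭ hub ∷ hub ∷ replicate (length N) left ++ replicate (length M) right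
  colours-↭ = subst (map colour (allFin n) ↭_) colours
    (Perm.map⁺ colour (unique-↭ unique (Unique.allFin⁺ n) (λ _ → ∈-allFin _) (λ _ → covers _)))
    where
    colours : map colour (u ∷ v ∷ N ++ M) ≡ hub ∷ hub ∷ replicate (length N) left ++ replicate (length M) right
    colours = cong₂ _∷_ (colour-hub u∉) (cong₂ _∷_ (colour-hub v∉)
      (trans (List.map-++ colour N M) (cong₂ _++_ (map-const colour N colour-N) (map-const colour M colour-M))))

  flip-join : Join G M N
  flip-join = record
    { covers = λ x → Perm.∈-resp-↭ flip-↭ (covers x)
    ; unique = unique-↭⁺ flip-↭ unique
    ; u-all = u-all ; v-all = v-all
    ; across = λ {x} {y} x∈ y∈ → trans (adj-sym G x y) (across y∈ x∈)
    ; inside-N = inside-M ; inside-M = inside-N }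
    where
    flip-↭ : u ∷ v ∷ N ++ M ↭ u ∷ v ∷ M ++ N
    flip-↭ = prep u (prep v (Perm.++-comm N M))

  join-cliques : length N * length M ≤ numK4 G
  join-cliques = subst (_≤ numK4 G) (trans (List.length-map quad′ pairs) (length-cartesianProduct N M))
    (numK4-≥ (map-unique-∈ quad′ inj (Unique.cartesianProduct⁺ unique-N unique-M)) cl)
    where
    open Cliques G
    pairs = cartesianProduct N M
    quad′ : Fin n × Fin n → Subset n
    quad′ (x , y) = ⟪ u ⨾ v ⨾ x ⨾ y ⟫
    unique-N : Unique N
    unique-N = proj₁ (unique-++⁻ N unique-N++M)
    unique-M : Unique M
    unique-M = proj₂ (unique-++⁻ N unique-N++M)
    only : ∀ {x y z} → z ∈ N ++ M → z ∈ˢ ⟪ u ⨾ v ⨾ x ⨾ y ⟫ → z ≡ x ⊎ z ≡ y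
    only {x} {y} z∈ z∈′ with ∈⟪⟫⁻ (u ∷ v ∷ x ∷ y ∷ []) z∈′
    ... | here refl = contradiction refl (u∉ z∈)
    ... | there (here refl) = contradiction refl (v∉ z∈)
    ... | there (there (here z≡x)) = inj₁ z≡x
    ... | there (there (there (here z≡y))) = inj₂ z≡y
    inj : ∀ {p q} → p ∈ pairs → q ∈ pairs → quad′ p ≡ quad′ q → p ≡ q
    inj {x , y} {x′ , y′} p∈ q∈ eq with ∈-cartesianProduct⁻ N M p∈ | ∈-cartesianProduct⁻ N M q∈
    ... | x∈ , y∈ | x∈′ , y∈′
      with only {x′} {y′} (∈-++⁺ˡ x∈) (subst (x ∈ˢ_) eq (∈⟪⟫⁺ {xs = u ∷ v ∷ x ∷ y ∷ []} (there (there (here refl)))))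
         | only {x′} {y′} (∈-++⁺ʳ N y∈) (subst (y ∈ˢ_) eq (∈⟪⟫⁺ {xs = u ∷ v ∷ x ∷ y ∷ []} (there (there (there (here refl))))))
    ... | inj₁ refl | inj₂ refl = refl
    ... | inj₂ refl | _ = contradiction y∈′ (disjoint x∈)
    ... | _ | inj₁ refl = contradiction y∈ (disjoint x∈′)
    cl : ∀ {p} → p ∈ map quad′ pairs → Clique p
    cl p∈ with ∈-map⁻ quad′ p∈
    ... | (x , y) , xy∈ , refl with ∈-cartesianProduct⁻ N M xy∈
    ... | x∈ , y∈ = K₄-clique
      ((u-all u≢v ∷ u-all (u∉ (∈-++⁺ˡ x∈)) ∷ u-all (u∉ (∈-++⁺ʳ N y∈)) ∷ []) ∷
       (v-all (v∉ (∈-++⁺ˡ x∈)) ∷ v-all (v∉ (∈-++⁺ʳ N y∈)) ∷ []) ∷ (across x∈ y∈ ∷ []) ∷ [] ∷ [])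

  Hub : Fin n → Set
  Hub x = x ≡ u ⊎ x ≡ v

  triangle-hub : ∀ {a b c} → Cliques.Complete G (a ∷ b ∷ c ∷ []) → ∃ λ x → x ∈ a ∷ b ∷ c ∷ [] × Hub x
  triangle-hub {a} {b} {c} ((ab ∷ ac ∷ []) ∷ (bc ∷ []) ∷ _) with place a | place b | place c
  ... | is-u a≡ | _ | _ = a , here refl , inj₁ a≡
  ... | is-v a≡ | _ | _ = a , here refl , inj₂ a≡
  ... | _ | is-u b≡ | _ = b , there (here refl) , inj₁ b≡
  ... | _ | is-v b≡ | _ = b , there (here refl) , inj₂ b≡
  ... | _ | _ | is-u c≡ = c , there (there (here refl)) , inj₁ c≡
  ... | _ | _ | is-v c≡ = c , there (there (here refl)) , inj₂ c≡
  ... | in-N a∈ | in-N b∈ | _ = case trans (sym ab) (inside-N a∈ b∈) of λ ()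
  ... | in-N a∈ | in-M _ | in-N c∈ = case trans (sym ac) (inside-N a∈ c∈) of λ ()
  ... | in-N _ | in-M b∈ | in-M c∈ = case trans (sym bc) (inside-M b∈ c∈) of λ ()
  ... | in-M _ | in-N b∈ | in-N c∈ = case trans (sym bc) (inside-N b∈ c∈) of λ ()
  ... | in-M a∈ | in-N _ | in-M c∈ = case trans (sym ac) (inside-M a∈ c∈) of λ ()
  ... | in-M a∈ | in-M b∈ | _ = case trans (sym ab) (inside-M a∈ b∈) of λ ()

  -- Every triangle contains a hub. Removing that hub from the K₄ leaves a triangle, whose hub must
  -- be the other one.
  two-hubs : ∀ {a b c d} → Cliques.K₄ G a b c d → u ∈ a ∷ b ∷ c ∷ d ∷ [] × v ∈ a ∷ b ∷ c ∷ d ∷ []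
  two-hubs {a} {b} {c} {d} k@((ab ∷ ac ∷ ad ∷ []) ∷ (bc ∷ bd ∷ []) ∷ (cd ∷ []) ∷ _) =
    case triangle-hub ((ab ∷ ac ∷ []) ∷ (bc ∷ []) ∷ [] ∷ []) of λ
      { (_ , here refl , h) → first-hub k h
      ; (_ , there (here refl) , h) → permuted (↭-swap b a ↭-refl) (first-hub (swap₁₂ k) h)
      ; (_ , there (there (here refl)) , h) →
          permuted (↭-trans (↭-swap c a ↭-refl) (prep a (↭-swap c b ↭-refl))) (first-hub (swap₁₂ (swap₂₃ k)) h) }
    where
    open Cliques G
    permuted : ∀ {xs ys} → xs ↭ ys → u ∈ xs × v ∈ xs → u ∈ ys × v ∈ ys
    permuted p (u∈ , v∈) = Perm.∈-resp-↭ p u∈ , Perm.∈-resp-↭ p v∈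
    first-hub : ∀ {a b c d} → K₄ a b c d → Hub a → u ∈ a ∷ b ∷ c ∷ d ∷ [] × v ∈ a ∷ b ∷ c ∷ d ∷ []
    first-hub k@(_ ∷ bcd) h with triangle-hub bcd
    ... | y , y∈ , h′ = pick (All.lookup (AllPairs.head (complete-unique k)) y∈) h h′
      where
      pick : ∀ {x} → x ≢ y → Hub x → Hub y → u ∈ x ∷ _ × v ∈ x ∷ _
      pick x≢y (inj₁ refl) (inj₁ refl) = contradiction refl x≢y
      pick x≢y (inj₁ refl) (inj₂ refl) = here refl , there y∈
      pick x≢y (inj₂ refl) (inj₁ refl) = there y∈ , here refl
      pick x≢y (inj₂ refl) (inj₂ refl) = contradiction refl x≢y

  -- Both copies of K₄ contain u and v, which would have to be the one vertex that the copies share.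
  join-free : G -free B 4 1
  join-free (f , inj , hom) = u≢v (trans (at-3 (proj₁ first) (proj₁ second)) (sym (at-3 (proj₂ first) (proj₂ second))))
    where
    first : u ∈ map f (# 0 ∷ # 1 ∷ # 2 ∷ # 3 ∷ []) × v ∈ map f (# 0 ∷ # 1 ∷ # 2 ∷ # 3 ∷ [])
    first = two-hubs ((hom _ _ refl ∷ hom _ _ refl ∷ hom _ _ refl ∷ []) ∷ (hom _ _ refl ∷ hom _ _ refl ∷ []) ∷
      (hom (# 2) (# 3) refl ∷ []) ∷ [] ∷ [])
    second : u ∈ map f (# 3 ∷ # 4 ∷ # 5 ∷ # 6 ∷ []) × v ∈ map f (# 3 ∷ # 4 ∷ # 5 ∷ # 6 ∷ [])
    second = two-hubs ((hom (# 3) (# 4) refl ∷ hom (# 3) (# 5) refl ∷ hom (# 3) (# 6) refl ∷ []) ∷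
      (hom (# 4) (# 5) refl ∷ hom (# 4) (# 6) refl ∷ []) ∷ (hom (# 5) (# 6) refl ∷ []) ∷ [] ∷ [])
    at-3 : ∀ {x} → x ∈ map f (# 0 ∷ # 1 ∷ # 2 ∷ # 3 ∷ []) → x ∈ map f (# 3 ∷ # 4 ∷ # 5 ∷ # 6 ∷ []) → x ≡ f (# 3)
    at-3 x∈ x∈′ with ∈-map⁻ f x∈ | ∈-map⁻ f x∈′
    ... | i , i∈ , refl | j , j∈ , eq with inj eq
    ... | refl = cong f (common i∈ j∈)
      where
      common : ∀ {i} → i ∈ # 0 ∷ # 1 ∷ # 2 ∷ # 3 ∷ [] → i ∈ # 3 ∷ # 4 ∷ # 5 ∷ # 6 ∷ [] → i ≡ # 3
      common _ (here i≡) = i≡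
      common (here refl) (there (there (there (there ()))))
      common (there (here refl)) (there (there (there (there ()))))
      common (there (there (here refl))) (there (there (there (there ()))))
      common (there (there (there (here i≡)))) _ = i≡

join-≅ : ∀ {n} {G H : Graph n} {N M N′ M′} → Join G N M → Join H N′ M′ →
         length N ≡ length N′ → length M ≡ length M′ → G ≅ H
join-≅ {G = G} {H} {N} {M} {N′} {M′} J K N≡ M≡ = f , bijective , adjacency
  where
  colours : map (colour K) (allFin _) ↭ map (colour J) (allFin _)
  colours = ↭-trans (colours-↭ K) (subst (_↭ map (colour J) (allFin _))
    (cong₂ (λ a b → hub ∷ hub ∷ replicate a left ++ replicate b right) N≡ M≡) (↭-sym (colours-↭ J)))
  open Σ (recolouring (colour J) (colour K) colours) renaming (proj₁ to f; proj₂ to f-spec)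
  bijective = proj₁ f-spec
  adjacency : ∀ i j → adj G i j ≡ adj H (f i) (f j)
  adjacency i j with i ≟ j
  ... | yes refl = trans (adj-irrefl G i) (sym (adj-irrefl H (f i)))
  ... | no i≢j = begin
    adj G i j                                   ≡⟨ adj-colour J i≢j ⟩
    joined (colour J i) (colour J j)            ≡⟨ cong₂ joined (proj₂ f-spec i) (proj₂ f-spec j) ⟨
    joined (colour K (f i)) (colour K (f j))    ≡⟨ adj-colour K (i≢j ∘ proj₁ bijective) ⟨
    adj H (f i) (f j)                           ∎
    where open ≡-Reasoning

-- ⌊m²/4⌋ and balanced bipartitions

Balanced : ℕ → ℕ → Set
Balanced a b = a ≡ b ⊎ a ≡ suc b

-- The identity (a + b)² = 4ab + (a - b)², with a written as `b + k` to avoid subtraction.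
square-split : ∀ b k → ((b + k) + b) * ((b + k) + b) ≡ (b + k) * b * 4 + k * k
square-split = solve-∀

/4-unique : ∀ {q x} → q * 4 ≤ x → x < suc q * 4 → x / 4 ≡ q
/4-unique {q} {x} q≤ x< = ℕ.≤-antisym (ℕ.m<1+n⇒m≤n (m<n*o⇒m/o<n {x} {suc q} {4} x<))
  (ℕ.≤-trans (ℕ.≤-reflexive (sym (m*n/n≡m q 4))) (/-monoˡ-≤ 4 q≤))

product-≤ : ∀ a b → a * b ≤ (a + b) * (a + b) / 4
product-≤ a b = case ℕ.≤-total b a of λ { (inj₁ b≤a) → ordered b≤a ; (inj₂ a≤b) → flipped a≤b }
  where
  ordered : ∀ {a b} → b ≤ a → a * b ≤ (a + b) * (a + b) / 4
  ordered {a} {b} b≤a with ℕ.m≤n⇒∃[o]m+o≡n b≤a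
  ... | k , refl = ℕ.≤-trans (ℕ.≤-reflexive (sym (m*n/n≡m ((b + k) * b) 4)))
    (/-monoˡ-≤ 4 (ℕ.≤-trans (ℕ.m≤m+n _ (k * k)) (ℕ.≤-reflexive (sym (square-split b k)))))
  flipped : a ≤ b → a * b ≤ (a + b) * (a + b) / 4
  flipped a≤b = subst₂ (λ p s → p ≤ s * s / 4) (ℕ.*-comm b a) (ℕ.+-comm b a) (ordered a≤b)

balanced-product : ∀ {a b} → Balanced a b → a * b ≡ (a + b) * (a + b) / 4
balanced-product {a} {b} bal with excess bal
  where
  excess : Balanced a b → ∃ λ k → a ≡ b + k × k * k < 4
  excess (inj₁ refl) = 0 , sym (ℕ.+-identityʳ b) , s≤s z≤n
  excess (inj₂ refl) = 1 , ℕ.+-comm 1 b , s≤s (s≤s z≤n)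
... | k , refl , k²<4 = sym (/4-unique
  (ℕ.≤-trans (ℕ.m≤m+n _ (k * k)) (ℕ.≤-reflexive (sym (square-split b k))))
  (ℕ.≤-trans (s≤s (ℕ.≤-reflexive (square-split b k)))
    (ℕ.≤-trans (ℕ.≤-reflexive (sym (ℕ.+-suc _ (k * k)))) (ℕ.≤-trans (ℕ.+-monoʳ-≤ _ k²<4) (ℕ.≤-reflexive (ℕ.+-comm _ 4))))))

-- A difference k ≥ 2 contributes k² ≥ 4 in `square-split`, which lifts the quotient above the
-- product.
product-tight : ∀ {a b} → b ≤ a → (a + b) * (a + b) / 4 ≤ a * b → Balanced a b
product-tight {b = b} b≤a tight with ℕ.m≤n⇒∃[o]m+o≡n b≤a
... | 0 , refl = inj₁ (ℕ.+-identityʳ b)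
... | 1 , refl = inj₂ (ℕ.+-comm b 1)
... | k@(suc (suc j)) , refl = contradiction tight (ℕ.<⇒≱ (begin
  suc ((b + k) * b)                       ≡⟨ m*n/n≡m (suc ((b + k) * b)) 4 ⟨
  suc ((b + k) * b) * 4 / 4               ≤⟨ /-monoˡ-≤ 4 (begin
    4 + (b + k) * b * 4                     ≡⟨ ℕ.+-comm 4 _ ⟩
    (b + k) * b * 4 + 4                     ≤⟨ ℕ.+-monoʳ-≤ _ (ℕ.*-mono-≤ {2} {k} {2} {k} (s≤s (s≤s z≤n)) (s≤s (s≤s z≤n))) ⟩
    (b + k) * b * 4 + k * k                 ≡⟨ square-split b k ⟨
    ((b + k) + b) * ((b + k) + b)           ∎) ⟩
  ((b + k) + b) * ((b + k) + b) / 4       ∎))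
  where open ℕ.≤-Reasoning

balanced-determined : ∀ {a b c d} → Balanced a b → Balanced c d → a + b ≡ c + d → a ≡ c × b ≡ d
balanced-determined {a} {b} {c} {d} ab cd eq =
  trans (upper ab) (trans (cong ⌈_/2⌉ eq) (sym (upper cd))) ,
  trans (lower ab) (trans (cong ⌊_/2⌋ eq) (sym (lower cd)))
  where
  lower : ∀ {a b} → Balanced a b → b ≡ ⌊ a + b /2⌋
  lower {b = b} (inj₁ refl) = ℕ.n≡⌊n+n/2⌋ b
  lower {b = b} (inj₂ refl) = ℕ.n≡⌈n+n/2⌉ b
  upper : ∀ {a b} → Balanced a b → a ≡ ⌈ a + b /2⌉
  upper {a} (inj₁ refl) = ℕ.n≡⌈n+n/2⌉ a
  upper {b = b} (inj₂ refl) = cong suc (ℕ.n≡⌊n+n/2⌋ b)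

-- The parts of K₂ ∨ T₂(n - 2)

module Turán (m : ℕ) where

  order : ℕ
  order = suc (suc m)

  small even : Fin order → Bool
  small x = toℕ x <ᵇ 2
  even x = (toℕ x % 2) ≡ᵇ 0

  Part : Bool → Fin order → Set
  Part b x = small x ≡ false × even x ≡ b

  Part? : ∀ b → Decidable (Part b)
  Part? b x = (small x Bool.≟ false) ×-dec (even x Bool.≟ b)

  evens odds : List (Fin order)
  evens = enum (Part? true)
  odds = enum (Part? false)

  related : Bool → Bool → Bool → Bool → Bool
  related s t a b = s ∨ t ∨ (not (a ∧ b) ∧ (a ∨ b))

  adj-≢ : ∀ {x y} → x ≢ y → adj (K2∨T2 order) x y ≡ related (small x) (small y) (even x) (even y)
  adj-≢ {x} {y} x≢y = cong (λ e → not e ∧ related (small x) (small y) (even x) (even y)) eq-false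
    where
    eq-false : eqᵇ x y ≡ false
    eq-false with x ≟ y
    ... | yes x≡y = contradiction x≡y x≢y
    ... | no _ = refl

  turán-join : Join (K2∨T2 order) evens odds
  turán-join = record
    { u = zero ; v = suc zero
    ; covers = covers
    ; unique = ((λ ()) ∷ All.tabulate (λ {x} x∈ → ≢-small {zero} {x} refl (large x∈))) ∷
        All.tabulate (λ {x} x∈ → ≢-small {suc zero} {x} refl (large x∈)) ∷
        Unique.++⁺ (enum-unique (Part? true)) (enum-unique (Part? false))
          λ {x} (x∈ , x∈′) → parts-apart {x} {x} (∈-enum⁻ (Part? true) x∈) (∈-enum⁻ (Part? false) x∈′) refl
    ; u-all = λ {x} → adj-≢ {zero} {x}
    ; v-all = λ {x} → adj-≢ {suc zero} {x}
    ; across = λ {x} {y} x∈ y∈ → between {x = x} {y} (∈-enum⁻ (Part? true) x∈) (∈-enum⁻ (Part? false) y∈)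
    ; inside-N = λ {x} {y} x∈ y∈ → within {x = x} {y} (∈-enum⁻ (Part? true) x∈) (∈-enum⁻ (Part? true) y∈)
    ; inside-M = λ {x} {y} x∈ y∈ → within {x = x} {y} (∈-enum⁻ (Part? false) x∈) (∈-enum⁻ (Part? false) y∈)
    }
    where
    covers : ∀ x → x ∈ zero ∷ suc zero ∷ evens ++ odds
    covers zero = here refl
    covers (suc zero) = there (here refl)
    covers (suc (suc x)) with even (suc (suc x)) in eq
    ... | true = there (there (∈-++⁺ˡ (∈-enum⁺ (Part? true) (refl , eq))))
    ... | false = there (there (∈-++⁺ʳ evens (∈-enum⁺ (Part? false) (refl , eq))))

    large : ∀ {x} → x ∈ evens ++ odds → small x ≡ false
    large x∈ with ∈-++⁻ evens x∈
    ... | inj₁ x∈ = proj₁ (∈-enum⁻ (Part? true) x∈)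
    ... | inj₂ x∈ = proj₁ (∈-enum⁻ (Part? false) x∈)

    ≢-small : ∀ {x y} → small x ≡ true → small y ≡ false → x ≢ y
    ≢-small sx sy refl = case trans (sym sx) sy of λ ()

    parts-apart : ∀ {x y} → Part true x → Part false y → x ≢ y
    parts-apart (_ , ex) (_ , ey) refl = case trans (sym ex) ey of λ ()

    between : ∀ {x y} → Part true x → Part false y → adj (K2∨T2 order) x y ≡ true
    between {x} {y} px@(sx , ex) py@(sy , ey) = trans (adj-≢ {x} {y} (parts-apart {x} {y} px py)) (value sx sy ex ey)
      where
      value : ∀ {s t a b} → s ≡ false → t ≡ false → a ≡ true → b ≡ false → related s t a b ≡ true
      value refl refl refl refl = refl

    within : ∀ {b x y} → Part b x → Part b y → adj (K2∨T2 order) x y ≡ false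
    within {b} {x} {y} (sx , ex) (sy , ey) = case x ≟ y of λ
      { (yes refl) → adj-irrefl (K2∨T2 order) x ; (no x≢y) → trans (adj-≢ {x} {y} x≢y) (value b sx sy ex ey) }
      where
      value : ∀ b {s t a c} → s ≡ false → t ≡ false → a ≡ b → c ≡ b → related s t a c ≡ false
      value true refl refl refl refl = refl
      value false refl refl refl refl = refl

  next : Fin order → Fin order
  next x with suc (toℕ x) ℕ.<? order
  ... | yes x< = fromℕ< x<
  -- The last vertex has no successor; its value is arbitrary.
  ... | no _ = x

  next≡ : ∀ {x y} → toℕ y ≡ suc (toℕ x) → y ≡ next x
  next≡ {x} {y} y≡ with suc (toℕ x) ℕ.<? order
  ... | yes x< = Fin.toℕ-injective (trans y≡ (sym (Fin.toℕ-fromℕ< x<)))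
  ... | no x≮ = contradiction (subst (_< order) y≡ (Fin.toℕ<n y)) x≮

  parity-suc : ∀ k → (suc k % 2 ≡ᵇ 0) ≡ not (k % 2 ≡ᵇ 0)
  parity-suc 0 = refl
  parity-suc 1 = refl
  parity-suc (suc (suc k)) = parity-suc k

  predecessor : ∀ {b y} → Part b y → toℕ y ≡ 2 ⊎ ∃ λ x → Part (not b) x × y ≡ next x
  predecessor {y = suc (suc zero)} _ = inj₁ refl
  predecessor {b} {suc (suc (suc k))} (_ , ey) = inj₂ (inject₁ (suc (suc k)) ,
    (cong (_<ᵇ 2) index≡ , trans (cong (λ i → i % 2 ≡ᵇ 0) index≡)
      (trans (sym (Bool.not-involutive _)) (cong not (trans (sym (parity-suc (toℕ k))) ey)))) ,
    next≡ (cong suc (sym index≡)))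
    where
    index≡ : toℕ (inject₁ (suc (suc k))) ≡ suc (suc (toℕ k))
    index≡ = Fin.toℕ-inject₁ (suc (suc k))

  -- The images under `next` of the even part cover the odd part; those of the odd part together
  -- with vertex 1 cover the even part. So the sizes differ by at most one, in favour of the evens.
  balanced-parts : Balanced (length evens) (length odds)
  balanced-parts with ℕ.m≤n⇒∃[o]m+o≡n odds≤evens
    where
    odds≤evens : length odds ≤ length evens
    odds≤evens = few-length (few-map next preimage (few-card (Part? true))) (enum-unique (Part? false)) (∈-enum⁻ (Part? false))
      where
      preimage : ∀ {y} → Part false y → ∃ λ x → Part true x × y ≡ next x
      preimage {y} py@(_ , ey) with predecessor py
      ... | inj₁ y≡2 = case trans (sym ey) (cong (λ i → i % 2 ≡ᵇ 0) y≡2) of λ ()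
      ... | inj₂ found = found
  ... | 0 , eq = inj₁ (trans (sym eq) (ℕ.+-identityʳ _))
  ... | 1 , eq = inj₂ (trans (sym eq) (ℕ.+-comm _ 1))
  ... | suc (suc k) , eq = contradiction evens≤ (ℕ.<⇒≱ (subst (suc (length odds) <_) eq
      (ℕ.≤-trans (ℕ.≤-reflexive (ℕ.+-comm 2 _)) (ℕ.+-monoʳ-≤ (length odds) (s≤s (s≤s z≤n))))))
    where
    evens≤ : length evens ≤ 1 + length odds
    evens≤ = few-length (few-∪ (few-list (next (suc zero) ∷ []) here) (few-map next id (few-card (Part? false))) cases)
                        (enum-unique (Part? true)) (∈-enum⁻ (Part? true))
      where
      cases : ∀ {y} → Part true y → y ≡ next (suc zero) ⊎ ∃ λ x → Part false x × y ≡ next x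
      cases py = Sum.map₁ next≡ (predecessor py)

⊆-full : ∀ {A : Set} {xs ys : List A} → Unique xs → xs ⊆ ys → length ys ≤ length xs → ys ⊆ xs
⊆-full {xs = xs} uxs sub ≤ with extract uxs sub
... | [] , p = λ y∈ → subst (_ ∈_) (List.++-identityʳ xs) (Perm.∈-resp-↭ p y∈)
... | z ∷ zs , p = ⊥-elim (ℕ.m+1+n≰m (length xs)
  (ℕ.≤-trans (ℕ.≤-reflexive (trans (sym (List.length-++ xs)) (sym (Perm.↭-length p)))) ≤))

length-full : ∀ {n} {xs : List (Fin n)} → Unique xs → n ≤ length xs → ∀ x → x ∈ xs
length-full {n} {xs} uxs n≤ x = ⊆-full uxs (λ _ → ∈-allFin _)
  (subst (_≤ length xs) (sym (List.length-tabulate {n = n} id)) n≤) (∈-allFin x)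

turán-number : ℕ → ℕ
turán-number n = (n ∸ 2) * (n ∸ 2) / 4

Extremal : ∀ {n} → Graph n → Set
Extremal {n} G = numK4 G ≤ turán-number n × (numK4 G ≡ turán-number n → G ≅ K2∨T2 n)

parts-total : ∀ m → length (Turán.evens m) + length (Turán.odds m) ≡ m
parts-total m = ℕ.+-cancelʳ-≡ 2 _ _ (trans (Join.size (Turán.turán-join m)) (ℕ.+-comm 2 m))

-- A product that reaches ⌊(n - 2)²/4⌋ forces balanced parts, and their sizes are then determined by
-- their sum. Either part may be the larger, hence the flip.
join-≅-turán : ∀ {n} {G : Graph n} {N M} → Join G N M → turán-number n ≤ length N * length M → G ≅ K2∨T2 n
join-≅-turán {n} {G} {N} {M} J tight =
  at (length N + length M) (trans (sym (Join.size J)) (ℕ.+-comm _ 2)) refl J (ℕ.≤-total (length M) (length N)) tight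
  where
  at : ∀ {n G N M} m → n ≡ suc (suc m) → length N + length M ≡ m → Join {n} G N M →
       length M ≤ length N ⊎ length N ≤ length M → turán-number n ≤ length N * length M → G ≅ K2∨T2 n
  at {N = N} {M} m refl sum≡ J (inj₁ M≤N) tight =
    let N≡ , M≡ = balanced-determined
          (product-tight M≤N (subst (λ s → s * s / 4 ≤ length N * length M) (sym sum≡) tight))
          (Turán.balanced-parts m) (trans sum≡ (sym (parts-total m))) in
    join-≅ J (Turán.turán-join m) N≡ M≡
  at {N = N} {M} m refl sum≡ J (inj₂ N≤M) tight =
    let sum≡′ = trans (ℕ.+-comm (length M) _) sum≡
        M≡ , N≡ = balanced-determined
          (product-tight N≤M (subst₂ (λ s p → s * s / 4 ≤ p) (sym sum≡′) (ℕ.*-comm (length N) _) tight))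
          (Turán.balanced-parts m) (trans sum≡′ (sym (parts-total m))) in
    join-≅ (flip-join J) (Turán.turán-join m) M≡ N≡

-- Estimates for the peeled sets

4ab≤square : ∀ a b → 4 * (a * b) ≤ (a + b) * (a + b)
4ab≤square a b = ℕ.≤-trans (ℕ.≤-reflexive (ℕ.*-comm 4 (a * b)))
  (ℕ.≤-trans (ℕ.*-monoˡ-≤ 4 (product-≤ a b)) (m/n*n≤m ((a + b) * (a + b)) 4))

<-by : ∀ {a b} c → b ≡ suc (a + c) → a < b
<-by {a} c refl = s≤s (ℕ.m≤m+n a c)

-- Here `p` stands for n - 2. Of the slope 43f available in p²f the term c · p uses `c`; the
-- remaining slope `e` absorbs the constant `d`.
linear<quadratic : ∀ {p} c d e f → 43 ≤ p → d < e * 43 → c + e ≡ 43 * f → c * p + d < p * p * f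
linear<quadratic {p} c d e f 43≤p d< c+e≡ = begin-strict
  c * p + d         <⟨ ℕ.+-monoʳ-< (c * p) d< ⟩
  c * p + e * 43    ≤⟨ ℕ.+-monoʳ-≤ (c * p) (ℕ.*-monoʳ-≤ e 43≤p) ⟩
  c * p + e * p     ≡⟨ ℕ.*-distribʳ-+ p c e ⟨
  (c + e) * p       ≡⟨ cong (_* p) c+e≡ ⟩
  43 * f * p        ≤⟨ ℕ.*-monoˡ-≤ p (ℕ.*-monoˡ-≤ f 43≤p) ⟩
  p * f * p         ≡⟨ rearrange p f ⟩
  p * p * f         ∎
  where
  open ℕ.≤-Reasoning
  rearrange : ∀ p f → p * f * p ≡ p * p * f
  rearrange = solve-∀

-- n = 45 is the first value with 41 n < (n − 2)².
gain-vertex : ∀ {n} → 45 ≤ n → 4 * n * 10 + n < (n ∸ 2) * (n ∸ 2) * 1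
gain-vertex {suc (suc p)} (s≤s (s≤s 43≤p)) =
  subst (_< p * p * 1) (sym (expand p)) (linear<quadratic 41 82 2 1 43≤p (ℕ.m≤m+n 83 3) refl)
  where
  expand : ∀ p → 4 * (2 + p) * 10 + (2 + p) ≡ 41 * p + 82
  expand = solve-∀

-- The coefficients are 157 = 4 · 39 + 1, 314 = 2 · 157 and 15 = 43 · 4 - 157.
gain-clique : ∀ {n} → 45 ≤ n → 4 * n * 39 + n < (n ∸ 2) * (n ∸ 2) * 4
gain-clique {suc (suc p)} (s≤s (s≤s 43≤p)) =
  subst (_< p * p * 4) (sym (expand p)) (linear<quadratic 157 314 15 4 43≤p (ℕ.m≤m+n 315 330) refl)
  where
  expand : ∀ p → 4 * (2 + p) * 39 + (2 + p) ≡ 157 * p + 314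
  expand = solve-∀

gain-pair : ∀ {n k} → 45 ≤ n → 4 * k ≤ n → 4 * n * k + n < (n ∸ 2) * (n ∸ 2) * 2
gain-pair {n@(suc (suc p))} {k} (s≤s (s≤s 43≤p)) 4k≤n = begin-strict
  4 * n * k + n            ≡⟨ cong (_+ n) (rearrange n k) ⟩
  n * (4 * k) + n          ≤⟨ ℕ.+-monoˡ-≤ n (ℕ.*-monoʳ-≤ n 4k≤n) ⟩
  n * n + n                ≡⟨ expand p ⟩
  p * p + (5 * p + 6)      <⟨ ℕ.+-monoʳ-< (p * p) (linear<quadratic 5 6 38 1 43≤p (ℕ.m≤m+n 7 1627) refl) ⟩
  p * p + p * p * 1        ≡⟨ ℕ.*-suc (p * p) 1 ⟨
  p * p * 2                ∎
  where
  open ℕ.≤-Reasoning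
  rearrange : ∀ n k → 4 * n * k ≡ n * (4 * k)
  rearrange = solve-∀
  expand : ∀ p → (2 + p) * (2 + p) + (2 + p) ≡ p * p + (5 * p + 6)
  expand = solve-∀

-- The isolated ends fit among the n - |R| vertices outside `R`, and Mantel bounds 4ab by (a + b)².
-- Strictness of `2 + (a + b) < n` is essential: if `R` is everything, balanced `a` and `b` leave no
-- room for the summand `n`.
gain-wide : ∀ {n a b i s} → 11 ≤ a → 2 + (a + b) + i ≤ n → 2 + (a + b) < n → s ≤ b * a + i →
            4 * n * s + n < (n ∸ 2) * (n ∸ 2) * (2 + (a + b))
gain-wide {n} {a} {b} {i} {s} 11≤a ≤n <n s≤ with ℕ.m≤n⇒∃[o]m+o≡n <n
-- Only a + b ≥ 4 is used: with a + b = 4 + w′ the difference of the two sides in `identity` has no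
-- negative coefficient.
... | k′ , refl with ℕ.m≤n⇒∃[o]m+o≡n (ℕ.≤-trans (ℕ.≤-trans (ℕ.m≤m+n 4 7) 11≤a) (ℕ.m≤m+n a b))
... | w′ , w≡ = begin-strict
  4 * n * s + n                              ≤⟨ ℕ.+-monoˡ-≤ n (ℕ.*-monoʳ-≤ (4 * n) (ℕ.≤-trans s≤ (ℕ.+-monoʳ-≤ (b * a) i≤))) ⟩
  4 * n * (b * a + suc k′) + n               ≡⟨ rearrange n (b * a) (suc k′) ⟩
  n * (4 * (b * a)) + 4 * n * suc k′ + n     ≤⟨ ℕ.+-monoˡ-≤ n (ℕ.+-monoˡ-≤ (4 * n * suc k′) (ℕ.*-monoʳ-≤ n 4ba≤)) ⟩
  n * (w * w) + 4 * n * suc k′ + n           <⟨ subst Goal w≡ (<-by _ (identity w′ k′)) ⟩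
  (suc w + k′) * (suc w + k′) * (2 + w)      ∎
  where
  open ℕ.≤-Reasoning
  w = a + b
  Goal : ℕ → Set
  Goal w = (3 + w + k′) * (w * w) + 4 * (3 + w + k′) * suc k′ + (3 + w + k′) < (suc w + k′) * (suc w + k′) * (2 + w)
  rearrange : ∀ n p k → 4 * n * (p + k) + n ≡ n * (4 * p) + 4 * n * k + n
  rearrange = solve-∀
  i≤ : i ≤ suc k′
  i≤ = ℕ.+-cancelˡ-≤ (2 + w) _ _ (ℕ.≤-trans ≤n (ℕ.≤-reflexive (sym (ℕ.+-suc (2 + w) k′))))
  4ba≤ : 4 * (b * a) ≤ w * w
  4ba≤ = ℕ.≤-trans (4ab≤square b a) (ℕ.≤-reflexive (cong (λ s → s * s) (ℕ.+-comm b a)))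
  identity : ∀ w k → (5 + w + k) * (5 + w + k) * (6 + w) ≡
    suc ((7 + w + k) * ((4 + w) * (4 + w)) + 4 * (7 + w + k) * suc k + (7 + w + k) +
      (2 + 8 * w + w * w + k + k * w + k * (10 + 9 * w + w * w + 2 * k + k * w)))
  identity = solve-∀

-- The equality case of Mantel's bound

module ExtremalCase {n} (G : Graph n) (free : G -free B 4 1)
  (big : ∀ {p x} → Cliques.Clique G p → x ∈ˢ p → ¬ Few 10 (Solidity.Through G free x)) where

  open LinkCounts G free big

  module _ {u v} (u≢v : u ≢ v) (solid : Solid u v) where

    open Counting u≢v solid

    module _ {top} (top-branching : Branching top) (top-max : ∀ {x} → Branching x → degree x ≤ degree top) where

      open Branched top-branching top-max

      few-≤ : sum (map charge M) ≤ length M * length N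
      few-≤ = sum-≤ charge M charge-≤

      extremal : n ≤ length R → length I ≡ 0 → Extremal G
      extremal n≤R I≡0 = ℕ.≤-trans count≤ (ℕ.≤-trans few-≤ product≤) , λ eq → join-≅-turán (join eq) (begin
        turán-number n       ≡⟨ eq ⟨
        numK4 G              ≤⟨ count≤ ⟩
        sum (map charge M)   ≤⟨ few-≤ ⟩
        length M * length N  ≡⟨ ℕ.*-comm (length M) _ ⟩
        length N * length M  ∎)
        where
        open ℕ.≤-Reasoning

        in-R : ∀ x → x ∈ R
        in-R = length-full R-unique n≤R

        count≤ : numK4 G ≤ sum (map charge M)
        count≤ = numK4-≤ (few-mono (ℕ.≤-reflexive (trans (cong (sum (map charge M) +_) I≡0) (ℕ.+-identityʳ _)))
          all-through few-through)
          where
          all-through : ∀ {p} → Clique p → Through u p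
          all-through cl@(clique (x ∷ xs) _ _ refl) = R-through (cl , x , in-R x , ∈⟪⟫⁺ {xs = x ∷ xs} (here refl))

        n∸2≡ : length M + length N ≡ n ∸ 2
        n∸2≡ = trans (ℕ.+-comm (length M) _) (trans (sym (List.length-++ N))
          (cong (_∸ 2) (ℕ.≤-antisym (length-≤n R-unique) n≤R)))

        product≤ : length M * length N ≤ turán-number n
        product≤ = subst (λ s → length M * length N ≤ s * s / 4) n∸2≡ (product-≤ (length M) (length N))

        link-edge : ∀ {x y} → x ∈ N ++ M → y ∈ N ++ M → x ~ y → L x y
        link-edge x∈ y∈ xy with ∈N++M x∈ | ∈N++M y∈
        ... | _ , _ , ((uv ∷ ux ∷ _) ∷ (vx ∷ _) ∷ _) , _ | _ , _ , ((_ ∷ uy ∷ _) ∷ (vy ∷ _) ∷ _) , _ =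
          (uv ∷ ux ∷ uy ∷ []) ∷ (vx ∷ vy ∷ []) ∷ (xy ∷ []) ∷ [] ∷ []

        non-edge : ∀ {x y} → x ∈ N ++ M → y ∈ N ++ M → ¬ L x y → adj G x y ≡ false
        non-edge {x} {y} x∈ y∈ ¬xy with adj G x y in eq
        ... | true = contradiction (link-edge x∈ y∈ eq) ¬xy
        ... | false = refl

        module _ (eq : numK4 G ≡ turán-number n) where

          charge-full : ∀ {x} → x ∈ M → length N ≤ charge x
          charge-full = sum-≥⇒≡ charge M charge-≤
            (ℕ.≤-trans product≤ (ℕ.≤-trans (ℕ.≤-reflexive (sym eq)) count≤))

          M-outside : ∀ {x} → x ∈ M → ¬ L top x
          M-outside x∈ = proj₂ (∈-enum⁻ Other? x∈)

          -- Equality makes every vertex of `M` pay for `length N` edges. As its degree is no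
          -- larger, it pays for all its link edges, and an edge within `M` is payable only by its
          -- smaller end. Applied from both ends this excludes such edges.
          M-forward : ∀ {x y} → x ∈ M → y ∈ M → L x y → x <ᶠ y
          M-forward {x} {y} x∈ y∈ xy =
            let _ , c = ∈-enum⁻ (Charged? x) (⊆-full (enum-unique (Charged? x))
                  (∈-enum⁺ (L? x) ∘ proj₁ ∘ ∈-enum⁻ (Charged? x))
                  (ℕ.≤-trans (top-max (proj₁ (∈-enum⁻ Other? x∈))) (charge-full x∈)) (∈-enum⁺ (L? x) xy)) in
            Sum.[ (λ ty → contradiction ty (M-outside y∈)) , id ] c

          M-independent : ∀ {x y} → x ∈ M → y ∈ M → ¬ L x y
          M-independent x∈ y∈ xy = ℕ.<-asym (M-forward x∈ y∈ xy) (M-forward y∈ x∈ (swap₃₄ xy))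

          -- By independence of `M` the edges charged to `y` all end in `N`, and there are at least
          -- `length N` of them.
          N-complete : ∀ {x y} → x ∈ N → y ∈ M → x ~ y
          N-complete {x} {y} x∈ y∈ = ~-sym (edge (proj₁ (∈-enum⁻ (Charged? y)
            (⊆-full (enum-unique (Charged? y)) into-N (charge-full y∈) x∈))))
            where
            edge : ∀ {x y} → L x y → x ~ y
            edge (_ ∷ _ ∷ (xy ∷ []) ∷ _) = xy
            into-N : enum (Charged? y) ⊆ N
            into-N {z} z∈ with L? top z | ∈-enum⁻ (Charged? y) z∈
            ... | yes tz | _ = ∈-enum⁺ (L? top) tz
            ... | no ¬tz | yz , _ = contradiction yz (M-independent y∈
              (∈-enum⁺ Other? (branching-spreads (proj₁ (∈-enum⁻ Other? y∈)) yz , ¬tz)))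

          join : Join G N M
          join = record
            { covers = in-R
            ; unique = R-unique
            ; u-all = λ {x} → hub-u (in-R x)
            ; v-all = λ {x} → hub-v (in-R x)
            ; across = N-complete
            ; inside-N = λ x∈ y∈ → non-edge (∈-++⁺ˡ x∈) (∈-++⁺ˡ y∈)
                (¬LN (∈-enum⁻ (L? top) x∈) (∈-enum⁻ (L? top) y∈))
            ; inside-M = λ x∈ y∈ → non-edge (∈-++⁺ʳ N x∈) (∈-++⁺ʳ N y∈) (M-independent x∈ y∈)
            }
            where
            edges : ∀ {x} → x ∈ N ++ M → u ~ v × u ~ x × v ~ x
            edges x∈ with ∈N++M x∈
            ... | _ , _ , ((uv ∷ ux ∷ _) ∷ (vx ∷ _) ∷ _) , _ = uv , ux , vx
            uv : u ~ v
            uv = proj₁ (edges (N++M-∋ top-branching))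
            hub-u : ∀ {x} → x ∈ R → u ≢ x → u ~ x
            hub-u (here refl) u≢u = contradiction refl u≢u
            hub-u (there (here refl)) _ = uv
            hub-u (there (there x∈)) _ = proj₁ (proj₂ (edges x∈))
            hub-v : ∀ {x} → x ∈ R → v ≢ x → v ~ x
            hub-v (here refl) _ = ~-sym uv
            hub-v (there (here refl)) v≢v = contradiction refl v≢v
            hub-v (there (there x∈)) _ = proj₂ (proj₂ (edges x∈))

quarter : ∀ {n} a b c d → (a + b) + (c + d) ≤ n → 4 * a ≤ n ⊎ 4 * b ≤ n ⊎ 4 * c ≤ n ⊎ 4 * d ≤ n
quarter {n} a b c d ≤n with 4 * a ℕ.≤? n | 4 * b ℕ.≤? n | 4 * c ℕ.≤? n | 4 * d ℕ.≤? n
... | yes a≤ | _ | _ | _ = inj₁ a≤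
... | no _ | yes b≤ | _ | _ = inj₂ (inj₁ b≤)
... | no _ | no _ | yes c≤ | _ = inj₂ (inj₂ (inj₁ c≤))
... | no _ | no _ | no _ | yes d≤ = inj₂ (inj₂ (inj₂ d≤))
... | no a≰ | no b≰ | no c≰ | no d≰ = ⊥-elim (ℕ.<-irrefl refl (begin-strict
  (n + n) + (n + n)                      <⟨ ℕ.+-mono-< (ℕ.+-mono-< (ℕ.≰⇒> a≰) (ℕ.≰⇒> b≰)) (ℕ.+-mono-< (ℕ.≰⇒> c≰) (ℕ.≰⇒> d≰)) ⟩
  (4 * a + 4 * b) + (4 * c + 4 * d)      ≡⟨ collect a b c d ⟩
  4 * ((a + b) + (c + d))                ≤⟨ ℕ.*-monoʳ-≤ 4 ≤n ⟩
  4 * n                                  ≡⟨ double n ⟩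
  (n + n) + (n + n)                      ∎))
  where
  open ℕ.≤-Reasoning
  collect : ∀ a b c d → (4 * a + 4 * b) + (4 * c + 4 * d) ≡ 4 * ((a + b) + (c + d))
  collect = solve-∀
  double : ∀ n → 4 * n ≡ (n + n) + (n + n)
  double = solve-∀

-- Peeling

module Reductions {n} (G : Graph n) (free : G -free B 4 1) where

  open Solidity G free

  -- `gain` asks for more than the rate used in the induction: with the extra `n`, a single
  -- reduction already pushes the number of copies below ⌊(n - 2)²/4⌋. Uniqueness depends on this.
  record Reduction (A : List (Fin n)) : Set where
    constructor reduction
    field
      R        : List (Fin n)
      R-unique : Unique R
      R⊆A      : R ⊆ A
      k        : ℕ
      few      : Few k (Meets R)
      gain     : 4 * n * k + n < (n ∸ 2) * (n ∸ 2) * length R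

  -- `A` plays the part of the vertex set while the graph itself keeps all `n` vertices.
  Alive : List (Fin n) → Set
  Alive A = ∀ {p x} → Clique p → x ∈ˢ p → x ∈ A

  K₄-alive : ∀ {A a b c d} → Alive A → K₄ a b c d → a ∷ b ∷ c ∷ d ∷ [] ⊆ A
  K₄-alive {a = a} {b} {c} {d} alive k x∈ = alive (K₄-clique k) (∈⟪⟫⁺ {xs = a ∷ b ∷ c ∷ d ∷ []} x∈)

  Outcome : List (Fin n) → Set
  Outcome A = Reduction A ⊎ (n ≤ length A × Extremal G)

  module _ (45≤n : 45 ≤ n) {A} (alive : Alive A)
    (big : ∀ {p x} → Clique p → x ∈ˢ p → ¬ Few 10 (Through x)) where

    open LinkCounts G free big using (module Counting)

    module _ {u v} (u≢v : u ≢ v) (solid : Solid u v) where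

      open Counting u≢v solid

      module _ {top} (top-branching : Branching top) (top-max : ∀ {x} → Branching x → degree x ≤ degree top) where

        open Branched top-branching top-max

        R⊆A : R ⊆ A
        R⊆A (here refl) = let _ , _ , k , _ = top-branching in K₄-alive alive k (here refl)
        R⊆A (there (here refl)) = let _ , _ , k , _ = top-branching in K₄-alive alive k (there (here refl))
        R⊆A (there (there x∈)) = let _ , _ , k , _ = ∈N++M x∈ in K₄-alive alive k (there (there (here refl)))

        R≡ : length R ≡ 2 + (length N + length M)
        R≡ = cong (2 +_) (List.length-++ N)

        R+I≤n : length R + length I ≤ n
        R+I≤n = ℕ.≤-trans (ℕ.≤-reflexive (sym (List.length-++ R))) (length-≤n R++I-unique)

        -- `R` and `I` are disjoint, so an `R` of `n` vertices leaves no isolated link edge, as the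
        -- extremal case demands.
        top-outcome : Outcome A
        top-outcome with n ℕ.≤? length R
        ... | yes n≤R = inj₂ (ℕ.≤-trans n≤R (length-⊆ R-unique R⊆A) ,
            ExtremalCase.extremal G free big u≢v solid top-branching top-max n≤R
              (ℕ.n≤0⇒n≡0 (ℕ.+-cancelˡ-≤ (length R) _ _
                (ℕ.≤-trans R+I≤n (ℕ.≤-trans n≤R (ℕ.≤-reflexive (sym (ℕ.+-identityʳ _))))))))
        ... | no n≰R = inj₁ (reduction R R-unique R⊆A cost (few-mono ℕ.≤-refl R-through few-through)
            (subst (λ l → 4 * n * cost + n < (n ∸ 2) * (n ∸ 2) * l) (sym R≡)
              (gain-wide 11≤N (subst (λ l → l + length I ≤ n) R≡ R+I≤n) (subst (_< n) R≡ (ℕ.≰⇒> n≰R))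
                (ℕ.+-monoˡ-≤ (length I) (sum-≤ charge M charge-≤)))))
          where
          cost : ℕ
          cost = sum (map charge M) + length I

      branched-outcome : ∃ Branching → Outcome A
      branched-outcome branching =
        let _ , top-branching , top-max = maximum Branching? degree branching in top-outcome top-branching top-max

    pair-outcome : ∀ {u v x y k} → Solid u v → K₄ u v x y → 4 * k ≤ n → Few k (Through u) → Outcome A
    pair-outcome {u} {v} {k = k} solid xy@((uv ∷ _) ∷ _) 4k≤n few =
      inj₁ (reduction (u ∷ v ∷ []) ((~⇒≢ uv ∷ []) ∷ [] ∷ [])
        (λ { (here refl) → K₄-alive alive xy (here refl) ; (there (here refl)) → K₄-alive alive xy (there (here refl)) })
        k (few-mono ℕ.≤-refl through few) (gain-pair 45≤n 4k≤n))
      where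
      through : ∀ {p} → Meets (u ∷ v ∷ []) p → Through u p
      through (cl , _ , here refl , u∈) = cl , u∈
      through (cl , _ , there (here refl) , v∈) = cl , proj₂ solid cl v∈

    -- The supports of the two links are disjoint: a common vertex z would give a K₄ u v x z, so x would branch.
    matching-outcome : ∀ {u v x y} (uv : Solid u v) (xy : Solid x y) (k : K₄ u v x y) (u≢v : u ≢ v) (x≢y : x ≢ y) →
      (∀ z → ¬ Counting.Branching u≢v uv z) → (∀ z → ¬ Counting.Branching x≢y xy z) → Outcome A
    matching-outcome {u} {v} {x} {y} uv xy k@((u~v ∷ u~x ∷ u~y ∷ []) ∷ (v~x ∷ v~y ∷ []) ∷ _) u≢v x≢y none none′ =
      -- Lower and upper ends of the two matchings form four disjoint sets. One of them has at most
      -- n/4 vertices, and it counts the copies through its solid pair.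
      choose (quarter (card UV.Below?) (card UV.Above?) (card XY.Below?) (card XY.Above?) total)
      where
      module UV = Counting u≢v uv
      module XY = Counting x≢y xy
      k′ : K₄ x y u v
      k′ = swap₂₃ (swap₁₂ (swap₃₄ (swap₂₃ k)))
      ends-apart : ∀ {z} → z ∈ UV.ends none → z ∉ XY.ends none′
      ends-apart z∈ z∈′ with UV.∈-ends none z∈ | XY.∈-ends none′ z∈′
      ... | w , (_ ∷ u~z ∷ _) ∷ (v~z ∷ _) ∷ _ | w′ , (_ ∷ x~z ∷ _) ∷ (y~z ∷ _) ∷ _ =
        none x (y , _ , k , (u~v ∷ u~x ∷ u~z ∷ []) ∷ (v~x ∷ v~z ∷ []) ∷ (x~z ∷ []) ∷ [] ∷ [] , ~⇒≢ y~z)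
      total : (card UV.Below? + card UV.Above?) + (card XY.Below? + card XY.Above?) ≤ n
      total = begin
        (card UV.Below? + card UV.Above?) + (card XY.Below? + card XY.Above?)
          ≡⟨ cong₂ _+_ (List.length-++ (enum UV.Below?)) (List.length-++ (enum XY.Below?)) ⟨
        length (UV.ends none) + length (XY.ends none′)
          ≡⟨ List.length-++ (UV.ends none) ⟨
        length (UV.ends none ++ XY.ends none′)
          ≤⟨ length-≤n (Unique.++⁺ (UV.ends-unique none) (XY.ends-unique none′) λ (z∈ , z∈′) → ends-apart z∈ z∈′) ⟩
        n ∎
        where open ℕ.≤-Reasoning
      choose : _ → Outcome A
      choose (inj₁ a) = pair-outcome uv k a (UV.few-below none)
      choose (inj₂ (inj₁ b)) = pair-outcome uv k b (UV.few-above none)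
      choose (inj₂ (inj₂ (inj₁ c))) = pair-outcome xy k′ c (XY.few-below none′)
      choose (inj₂ (inj₂ (inj₂ d))) = pair-outcome xy k′ d (XY.few-above none′)

    -- If the link of `u v` does not branch, `x y` is an isolated edge of it, hence a solid pair
    -- whose own link is tried next.
    solid-outcome : ∀ {u v x y} → Solid u v → K₄ u v x y → Outcome A
    solid-outcome {u} {v} {x} {y} uv k@((u~v ∷ _) ∷ _ ∷ (x~y ∷ []) ∷ _)
      with Fin.any? (Counting.Branching? (~⇒≢ u~v) uv)
    ... | yes branching = branched-outcome (~⇒≢ u~v) uv branching
    ... | no none with UV.isolated-solid (UV.isolated (λ b → none (_ , b)) k)
      where module UV = Counting (~⇒≢ u~v) uv
    ... | xy with Fin.any? (Counting.Branching? (~⇒≢ x~y) xy)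
    ... | yes branching = branched-outcome (~⇒≢ x~y) xy branching
    ... | no none′ = matching-outcome uv xy k (~⇒≢ u~v) (~⇒≢ x~y) (λ z b → none (z , b)) (λ z b → none′ (z , b))

    clique-outcome : ∀ {a b c d} → K₄ a b c d → Outcome A
    clique-outcome {a} {b} {c} {d} k
      with some? (λ u v → Solid? u v ×-dec some? (K₄? u v))
    ... | yes (_ , _ , solid , _ , _ , k′) = solid-outcome solid k′
    ... | no none = inj₁ (reduction (a ∷ b ∷ c ∷ d ∷ []) (complete-unique k) (K₄-alive alive k) 39
      (NoSolidPair.meets-≤39 G free big (λ k solid → none (_ , _ , solid , _ , _ , k)) k) (gain-clique 45≤n))

  cliques-through : Fin n → List (Subset n)
  cliques-through x = filter (x Sub.∈?_) cliques

  ∈-through⁺ : ∀ {x p} → Through x p → p ∈ cliques-through x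
  ∈-through⁺ {x} (cl , x∈) = ∈-filter⁺ (x Sub.∈?_) (∈-cliques⁺ cl) x∈

  ∈-through⁻ : ∀ {x p} → p ∈ cliques-through x → Through x p
  ∈-through⁻ {x} p∈ = let p∈ , x∈ = ∈-filter⁻ (x Sub.∈?_) {xs = cliques} p∈ in ∈-cliques⁻ p∈ , x∈

  outcome : 45 ≤ n → ∀ {A} → Alive A → ∃ (_∈ A) → Outcome A
  outcome 45≤n {A} alive (x₀ , x₀∈) with any? (λ x → length (cliques-through x) ℕ.≤? 10) A
  ... | yes light = let x , x∈ , ≤10 = find light in
    inj₁ (reduction (x ∷ []) ([] ∷ []) (λ { (here refl) → x∈ }) 10
      (few-mono ≤10 (λ { (cl , _ , here refl , x∈p) → cl , x∈p }) (few-list (cliques-through x) ∈-through⁺))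
      (gain-vertex 45≤n))
  ... | no heavy =
    let p , p∈ = inhabited (cliques-through x₀) (heavy ∘ lose x₀∈)
        cl , x₀∈p = ∈-through⁻ p∈
        _ , _ , _ , k , _ = through₁ cl x₀∈p
    in clique-outcome 45≤n alive big k
    where
    inhabited : ∀ (ps : List (Subset n)) → ¬ (length ps ≤ 10) → ∃ (_∈ ps)
    inhabited [] empty = contradiction z≤n empty
    inhabited (p ∷ _) _ = p , here refl
    big : ∀ {p x} → Clique p → x ∈ˢ p → ¬ Few 10 (Through x)
    big {x = x} cl x∈p few = heavy (lose (alive cl x∈p)
      (few-length few (Unique.filter⁺ (x Sub.∈?_) cliques-unique) ∈-through⁻))

-- Deleting vertices

module Deletion {n} (G : Graph n) (R : List (Fin n)) where

  keep : Fin n → Bool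
  keep x = not ⌊ any? (x ≟_) R ⌋

  -- The vertices of `R` are only isolated, so the type of the graph and the constant `n` survive
  -- the induction.
  G∖R : Graph n
  G∖R = record
    { adj = λ i j → adj G i j ∧ (keep i ∧ keep j)
    ; adj-sym = λ i j → cong₂ _∧_ (adj-sym G i j) (Bool.∧-comm (keep i) (keep j))
    ; adj-irrefl = λ i → cong (_∧ (keep i ∧ keep i)) (adj-irrefl G i)
    }

  private
    module G = Cliques G
    module G∖R = Cliques G∖R

  ~⁻ : ∀ {x y} → x G∖R.~ y → x G.~ y × x ∉ R
  ~⁻ {x} {y} e with adj G x y | any? (x ≟_) R
  ... | true | no x∉ = refl , x∉

  ~⁺ : ∀ {x y} → x G.~ y → x ∉ R → y ∉ R → x G∖R.~ y
  ~⁺ {x} {y} e x∉ y∉ rewrite e with any? (x ≟_) R | any? (y ≟_) R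
  ... | no _ | no _ = refl
  ... | yes x∈ | _ = contradiction x∈ x∉
  ... | _ | yes y∈ = contradiction y∈ y∉

  deletion-free : ∀ {k} {F : Graph k} → G -free F → G∖R -free F
  deletion-free free (f , inj , hom) = free (f , inj , λ i j e → proj₁ (~⁻ (hom i j e)))

  clique-deletion⁻ : ∀ {p} → G∖R.Clique p → G.Clique p
  clique-deletion⁻ (G∖R.clique vs four comp p≡) = G.clique vs four (AllPairs.map (proj₁ ∘ ~⁻) comp) p≡

  clique-deletion-∉ : ∀ {p x} → G∖R.Clique p → x ∈ˢ p → x ∉ R
  clique-deletion-∉ cl x∈ with G∖R.through₁ cl x∈
  ... | _ , _ , _ , (xb ∷ _) ∷ _ , _ = proj₂ (~⁻ xb)

  clique-deletion⁺ : ∀ {p} → G.Clique p → (∀ {x} → x ∈ R → x ∉ˢ p) → G∖R.Clique p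
  clique-deletion⁺ (G.clique vs four comp refl) avoid =
    G∖R.clique vs four (kept comp (λ x∈ x∈R → avoid x∈R (∈⟪⟫⁺ {xs = vs} x∈))) refl
    where
    kept : ∀ {xs} → G.Complete xs → (∀ {x} → x ∈ xs → x ∉ R) → G∖R.Complete xs
    kept [] _ = []
    kept (xs~ ∷ comp) ∉R =
      All.tabulate (λ y∈ → ~⁺ (All.lookup xs~ y∈) (∉R (here refl)) (∉R (there y∈))) ∷ kept comp (∉R ∘ there)

-- The induction and the theorem

module Induction {n} (45≤n : 45 ≤ n) where

  open Reductions using (Alive; Reduction; outcome)

  capacity : ℕ
  capacity = (n ∸ 2) * (n ∸ 2)

  remaining : List (Fin n) → List (Fin n) → List (Fin n)
  remaining R = filter (λ x → ¬? (any? (x ≟_) R))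

  -- The rate (n - 2)²/4n per vertex of `A`, cleared of denominators; when `A` is everything it says
  -- that 4 · `numK4 G` ≤ (n - 2)².
  Bounded : ℕ → Set
  Bounded m = ∀ (G : Graph n) (free : G -free B 4 1) A → length A ≤ m → Unique A → Alive G free A →
              4 * n * numK4 G ≤ capacity * length A

  reduce : ∀ {m} → Bounded m → ∀ (G : Graph n) free {A} → length A ≤ suc m → Unique A → Alive G free A →
           Reduction G free A → 4 * n * numK4 G + n < capacity * length A
  reduce {m} bounded G free {A} ≤m uA alive red = begin-strict
    4 * n * numK4 G + n                              ≤⟨ ℕ.+-monoˡ-≤ n (ℕ.*-monoʳ-≤ (4 * n) split-count) ⟩
    4 * n * (k + numK4 G∖R) + n                      ≡⟨ rearrange (4 * n) k (numK4 G∖R) n ⟩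
    4 * n * k + n + 4 * n * numK4 G∖R                <⟨ ℕ.+-mono-<-≤ gain (bounded G∖R (deletion-free {F = B 4 1} free) A′ A′≤m uA′ alive′) ⟩
    capacity * length R + capacity * length A′       ≡⟨ ℕ.*-distribˡ-+ capacity (length R) (length A′) ⟨
    capacity * (length R + length A′)                ≤⟨ ℕ.*-monoʳ-≤ capacity lengths ⟩
    capacity * length A                              ∎
    where
    open ℕ.≤-Reasoning
    open Reduction red
    open Deletion G R
    rearrange : ∀ a k x n → a * (k + x) + n ≡ a * k + n + a * x
    rearrange = solve-∀

    A′ : List (Fin n)
    A′ = remaining R A

    uA′ : Unique A′
    uA′ = Unique.filter⁺ (λ x → ¬? (any? (x ≟_) R)) uA

    A′⁻ : ∀ {x} → x ∈ A′ → x ∈ A × x ∉ R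
    A′⁻ = ∈-filter⁻ (λ x → ¬? (any? (x ≟_) R)) {xs = A}

    lengths : length R + length A′ ≤ length A
    lengths = ℕ.≤-trans (ℕ.≤-reflexive (sym (List.length-++ R)))
      (length-⊆ (Unique.++⁺ R-unique uA′ λ (x∈R , x∈A′) → proj₂ (A′⁻ x∈A′) x∈R)
        λ x∈ → Sum.[ R⊆A , proj₁ ∘ A′⁻ ] (∈-++⁻ R x∈))

    A′≤m : length A′ ≤ m
    A′≤m = ℕ.+-cancelˡ-≤ 1 _ _ (ℕ.≤-trans (ℕ.≤-trans (ℕ.+-monoˡ-≤ (length A′) (nonempty (length R) gain)) lengths) ≤m)
      where
      -- Strictness of `gain` excludes an empty `R`; this makes the induction descend.
      nonempty : ∀ l → 4 * n * k + n < capacity * l → 1 ≤ l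
      nonempty zero g = contradiction (subst (4 * n * k + n <_) (ℕ.*-zeroʳ capacity) g) ℕ.n≮0
      nonempty (suc l) _ = s≤s z≤n

    alive′ : Alive G∖R (deletion-free {F = B 4 1} free) A′
    alive′ cl x∈ = ∈-filter⁺ (λ x → ¬? (any? (x ≟_) R)) (alive (clique-deletion⁻ cl) x∈) (clique-deletion-∉ cl x∈)

    split-count : numK4 G ≤ k + numK4 G∖R
    split-count = Cliques.numK4-≤ G (few-∪ few
      (few-mono (ℕ.≤-reflexive (sym (Cliques.numK4≡length G∖R))) (Cliques.∈-cliques⁺ G∖R)
        (few-list (Cliques.cliques G∖R) id))
      λ {p} cl → classify cl (any? (Sub._∈? p) R))
      where
      classify : ∀ {p} → Cliques.Clique G p → Dec (Any (_∈ˢ p) R) →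
                 Solidity.Meets G free R p ⊎ Cliques.Clique G∖R p
      classify cl (yes meets) = inj₁ (cl , find meets)
      classify cl (no avoids) = inj₂ (clique-deletion⁺ cl λ x∈R x∈p → avoids (lose x∈R x∈p))

  extremal-bound : ∀ {N l} → N ≤ turán-number n → n ≤ l → 4 * n * N ≤ capacity * l
  extremal-bound {N} {l} N≤ n≤l = begin
    4 * n * N                   ≤⟨ ℕ.*-monoʳ-≤ (4 * n) N≤ ⟩
    4 * n * turán-number n      ≡⟨ rearrange n (turán-number n) ⟩
    turán-number n * 4 * n      ≤⟨ ℕ.*-mono-≤ (m/n*n≤m capacity 4) n≤l ⟩
    capacity * l                ∎
    where
    open ℕ.≤-Reasoning
    rearrange : ∀ n q → 4 * n * q ≡ q * 4 * n
    rearrange = solve-∀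

  bounded : ∀ m → Bounded m
  bounded m G free [] _ _ alive = ℕ.≤-trans (ℕ.*-monoʳ-≤ (4 * n) (Cliques.numK4-≤ G (few-∅ none)))
    (ℕ.≤-trans (ℕ.≤-reflexive (ℕ.*-zeroʳ (4 * n))) z≤n)
    where
    none : ∀ {p} → ¬ Cliques.Clique G p
    none cl@(Cliques.clique (x ∷ xs) _ _ refl) = case alive cl (∈⟪⟫⁺ {xs = x ∷ xs} (here refl)) of λ ()
  bounded (suc m) G free (x ∷ A) ≤m uA alive with outcome G free 45≤n alive (x , here refl)
  ... | inj₁ red = ℕ.≤-trans (ℕ.m≤m+n _ n) (ℕ.<⇒≤ (reduce (bounded m) G free ≤m uA alive red))
  ... | inj₂ (n≤ , ≤turán , _) = extremal-bound ≤turán n≤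

  everything-alive : ∀ G free → Alive G free (allFin n)
  everything-alive G free _ _ = ∈-allFin _

  numK4-≤-turán : ∀ G → G -free B 4 1 → numK4 G ≤ turán-number n
  numK4-≤-turán G free = ℕ.≤-trans (ℕ.≤-reflexive (sym (m*n/n≡m (numK4 G) 4)))
    (/-monoˡ-≤ 4 (ℕ.*-cancelˡ-≤ n {{>-nonZero (ℕ.≤-trans (s≤s z≤n) 45≤n)}} (begin
      n * (numK4 G * 4)            ≡⟨ rearrange n (numK4 G) ⟩
      4 * n * numK4 G              ≤⟨ bounded n G free (allFin n) (ℕ.≤-reflexive |A|≡) (Unique.allFin⁺ n) (everything-alive G free) ⟩
      capacity * length (allFin n) ≡⟨ trans (cong (capacity *_) |A|≡) (ℕ.*-comm capacity n) ⟩
      n * capacity                 ∎)))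
    where
    open ℕ.≤-Reasoning
    |A|≡ : length (allFin n) ≡ n
    |A|≡ = List.length-tabulate id
    rearrange : ∀ n x → n * (x * 4) ≡ 4 * n * x
    rearrange = solve-∀

  -- A reduction of the full graph would give 4 · n · `numK4 G` + n < n(n - 2)². But (n - 2)² ≤ 4 ·
  -- `numK4 G` + 1 when the maximum is attained, so only the extremal outcome remains.
  numK4-≡-turán : (∀ q → q ≡ turán-number n → capacity ≤ q * 4 + 1) →
                  ∀ G → G -free B 4 1 → numK4 G ≡ turán-number n → G ≅ K2∨T2 n
  numK4-≡-turán near G free eq with outcome G free 45≤n (everything-alive G free) (fromℕ< (ℕ.≤-trans (s≤s (z≤n {44})) 45≤n) , ∈-allFin _)
  ... | inj₂ (_ , _ , unique) = unique eq
  ... | inj₁ red = contradiction (reduce (bounded n) G free (ℕ.≤-trans (ℕ.≤-reflexive |A|≡) (ℕ.n≤1+n n))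
                                   (Unique.allFin⁺ n) (everything-alive G free) red) (ℕ.≤⇒≯ (begin
      capacity * length (allFin n) ≡⟨ cong (capacity *_) |A|≡ ⟩
      capacity * n                 ≤⟨ ℕ.*-monoˡ-≤ n (near (numK4 G) eq) ⟩
      (numK4 G * 4 + 1) * n        ≡⟨ rearrange n (numK4 G) ⟩
      4 * n * numK4 G + n          ∎))
    where
    open ℕ.≤-Reasoning
    |A|≡ : length (allFin n) ≡ n
    |A|≡ = List.length-tabulate id
    rearrange : ∀ n x → (x * 4 + 1) * n ≡ 4 * n * x + n
    rearrange = solve-∀

balanced-square : ∀ {a b} → Balanced a b → (a + b) * (a + b) ≤ a * b * 4 + 1
balanced-square {b = b} (inj₁ refl) = ℕ.≤-trans (ℕ.≤-reflexive (expand b)) (ℕ.m≤m+n _ 1)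
  where
  expand : ∀ b → (b + b) * (b + b) ≡ b * b * 4
  expand = solve-∀
balanced-square {b = b} (inj₂ refl) = ℕ.≤-reflexive (expand b)
  where
  expand : ∀ b → (suc b + b) * (suc b + b) ≡ suc b * b * 4 + 1
  expand = solve-∀

module _ (m : ℕ) where

  open Turán m

  turán-product : length evens * length odds ≡ turán-number order
  turán-product = trans (balanced-product balanced-parts) (cong (λ s → s * s / 4) (parts-total m))

  turán-number-near : m * m ≤ turán-number order * 4 + 1
  turán-number-near = subst₂ (λ s q → s * s ≤ q * 4 + 1) (parts-total m) turán-product (balanced-square balanced-parts)

theorem1p3 : (n : ℕ) → n ≥ 45 →
    ((G : Graph n) → G -free B 4 1 → numK4 G ≤ ((n ∸ 2) * (n ∸ 2)) / 4)
    × (K2∨T2 n -free B 4 1)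
    × (numK4 (K2∨T2 n) ≡ ((n ∸ 2) * (n ∸ 2)) / 4)
    × ((G : Graph n) → G -free B 4 1 → numK4 G ≡ ((n ∸ 2) * (n ∸ 2)) / 4 → G ≅ K2∨T2 n)
theorem1p3 n@(suc (suc m)) 45≤n@(s≤s (s≤s _)) =
  numK4-≤-turán , turán-free ,
  ℕ.≤-antisym (numK4-≤-turán (K2∨T2 n) turán-free)
    (subst (_≤ numK4 (K2∨T2 n)) (turán-product m) (join-cliques turán-join)) ,
  numK4-≡-turán (λ { q refl → turán-number-near m })
  where
  open Induction 45≤n
  open Turán m using (turán-join)
  turán-free : K2∨T2 n -free B 4 1
  turán-free = join-free turán-join
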